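{- For every integer $n\ge1$, let $\gamma^{\mathrm{peak}}_{\mathcal A(2n)}(t)$ be the gamma-polynomial of the symmetric polynomial $\mathrm{Peak}_{\mathcal A(2n)}(t)/t$, where $\mathrm{Peak}_{\mathcal A(m)}(t)=\sum_{\mathbf a\in\mathcal A(m)}t^{\mathrm{peak}(\mathbf a)}$. Then $$\gamma^{\mathrm{peak}}_{\mathcal A(2n)}(t)=\sum_{i=0}^{\lfloor\frac n2\rfloor}2^{2i}\binom{n}{2i}t^i=\frac{(1+2\sqrt t)^n+(1-2\sqrt t)^n}{2}.$$ Moreover, for each such $i$, $2^{2i}\binom{n}{2i}$ is the number of Abelian Dyck paths $(k,L)$ of semilength $2n$ with $i+1$ peaks such that, writing the augmented word $LE=S_1S_2\cdots S_{2n}S_{2n+1}$ (obtained by appending a step $E$ to $L$), there is no $j\in[n]$ with $S_{2j-1}S_{2j}S_{2j+1}=ENE$ or $S_{2j-1}S_{2j}S_{2j+1}=NEN$.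
   Context: Write $[n]=\{1,\dots,n\}$. An area sequence of size $m$ is a sequence $\mathbf a=(a_1,\dots,a_m)$ of nonnegative integers with $a_i<i$ for all $i$ and $a_i\le a_{i-1}+1$ for all $i\ge 2$. Each area sequence $\mathbf a$ defines a graph $\Gamma_{\mathbf a}$ (a unit interval graph) on $[m]$ with edges $\{j,i\}$ for $1\le j<i\le m$ with $i-a_i\le j$. A peak-edge of $\Gamma_{\mathbf a}$ is either an isolated vertex or an edge $\{i,j\}$, $i<j$, such that neither $\{i,j+1\}$ nor $\{i-1,j\}$ is an edge (pairs not contained in $[m]$ are not edges); $\mathrm{peak}(\mathbf a)$ is the number of peak-edges. $\mathbf a$ is Abelian if every vertex $i\ne 1,m$ of $\Gamma_{\mathbf a}$ is adjacent to at least one of $1$ and $m$; $\mathcal A(m)$ is the set of Abelian area sequences of size $m$. Area sequences of size $m$ correspond bijectively to Dyck paths of semilength $m$, i.e. lattice paths from $(0,0)$ to $(m,m)$ with steps $N=(0,1)$, $E=(1,0)$ staying weakly above the diagonal: the $i$-th $N$ step of the path lies on the line $x=i-1-a_i$. A peak of a Dyck path is an $N$ step immediately followed by an $E$ step; the number of peaks of the path equals $\mathrm{peak}(\mathbf a)$. A Dyck path is Abelian if its area sequence is. Every Abelian Dyck path of semilength $m$ is uniquely of the form $N^kLE^{m-k}$ with $1\le k\le m$ and $L$ a path with steps $N,E$ from $(0,k)$ to $(k,m)$ whose first step is $E$; it is denoted $(k,L)$, and conversely each such pair gives an Abelian Dyck path. The peaks counted are those of the whole Dyck path $(k,L)$.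 A polynomial $p(t)$ of degree $d$ is symmetric if $p(t)=t^dp(1/t)$; then $p(t)=\sum_{0\le 2i\le d}\gamma_it^i(1+t)^{d-2i}$ uniquely and $\gamma_p(t)=\sum_i\gamma_it^i$ is its gamma-polynomial. -}

module Defs where

open import Data.Fin.Base using (Fin; toℕ)
open import Data.Fin.Properties using (all?; any?)
open import Data.Integer.Base as ℤ using (ℤ; +_)
open import Data.List.Base
  using (List; []; _∷_; _++_; map; foldr; filter; length; replicate; take; drop
        ; upTo; allFin; cartesianProduct; cartesianProductWith)
open import Data.List.Membership.Propositional using (_∈_)
open import Data.List.Membership.Propositional.Properties
  using (∈-cartesianProductWith⁺; ∈-filter⁺; ∈-filter⁻; ∈-upTo⁺)
open import Data.List.Relation.Unary.Any using (here)
open import Data.List.Relation.Unary.All using ([])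
open import Data.List.Relation.Unary.AllPairs using ([]; _∷_)
open import Data.List.Relation.Unary.Unique.Propositional using (Unique)
import Data.List.Relation.Unary.Unique.Propositional.Properties as Unique
open import Data.Nat.Base
open import Data.Nat.Properties using (_≟_; _≤?_; _<?_; ≤-trans)
open import Data.Product.Base using (∃-syntax; _×_; _,_; proj₂)
open import Data.Sum.Base using (_⊎_)
open import Data.Vec.Base as Vec using (Vec; lookup)
open import Data.Vec.Properties using (∷-injective)
open import Function.Base using (_∘_)
open import Function.Bundles using (_⇔_; mk⇔)
open import Relation.Binary.PropositionalEquality using (_≡_; _≢_; refl)
open import Relation.Nullary using (¬_; Dec)
open import Relation.Nullary.Decidable using (_×-dec_; _⊎-dec_; _→-dec_; ¬?)

------------------------------------------------------------------------
-- Univariate polynomials over ℤ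

-- Coefficient lists, constant term first. Trailing zeros are allowed, so
-- equality of polynomials is _≈_ rather than _≡_.
Poly : Set
Poly = List ℤ

coeff : Poly → ℕ → ℤ
coeff []      _       = + 0
coeff (c ∷ p) zero    = c
coeff (c ∷ p) (suc k) = coeff p k

infix  4 _≈_
infixl 6 _⊞_ _⊟_
infixl 7 _⊠_ _∙_
infixr 8 _^ᴾ_
infixr 9 _⟪_⟫

_≈_ : Poly → Poly → Set
p ≈ q = ∀ k → coeff p k ≡ coeff q k

_⊞_ : Poly → Poly → Poly
[]      ⊞ q       = q
(a ∷ p) ⊞ []      = a ∷ p
(a ∷ p) ⊞ (b ∷ q) = (a ℤ.+ b) ∷ (p ⊞ q)

_∙_ : ℤ → Poly → Poly
a ∙ p = map (a ℤ.*_) p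

_⊟_ : Poly → Poly → Poly
p ⊟ q = p ⊞ (ℤ.- (+ 1) ∙ q)

_⊠_ : Poly → Poly → Poly
[]      ⊠ q = []
(a ∷ p) ⊠ q = (a ∙ q) ⊞ (+ 0 ∷ (p ⊠ q))

𝟙 : Poly
𝟙 = + 1 ∷ []

X : Poly
X = + 0 ∷ + 1 ∷ []

_^ᴾ_ : Poly → ℕ → Poly
p ^ᴾ zero  = 𝟙
p ^ᴾ suc k = p ⊠ (p ^ᴾ k)

-- Substitution of q for the variable of p.
_⟪_⟫ : Poly → Poly → Poly
[]      ⟪ q ⟫ = []
(a ∷ p) ⟪ q ⟫ = (a ∷ []) ⊞ (q ⊠ (p ⟪ q ⟫))

∑ : List Poly → Poly
∑ = foldr _⊞_ []

∑[0⋯_] : ℕ → (ℕ → Poly) → Poly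
∑[0⋯ n ] f = ∑ (map f (upTo (suc n)))

HasDegree : Poly → ℕ → Set
HasDegree p d = coeff p d ≢ + 0 × (∀ k → d < k → coeff p k ≡ + 0)

-- p(t) = tᵈ p(1/t), where d is the degree of p: the coefficient of tᵏ on
-- the right-hand side is that of tᵈ⁻ᵏ in p.
IsSymmetric : Poly → ℕ → Set
IsSymmetric p d = HasDegree p d × (∀ k → k ≤ d → coeff p k ≡ coeff p (d ∸ k))

record IsGammaPolynomial (p γ : Poly) : Set where
  field
    d         : ℕ
    symmetric : IsSymmetric p d
    bounded   : ∀ i → d < 2 * i → coeff γ i ≡ + 0
    expansion : p ≈ ∑[0⋯ ⌊ d /2⌋ ] λ i →
                      coeff γ i ∙ (X ^ᴾ i ⊠ (𝟙 ⊞ X) ^ᴾ (d ∸ 2 * i))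

------------------------------------------------------------------------
-- Area sequences and unit interval graphs

-- An element of Fin m stands for the vertex (or position) label in
-- {1, …, m}; the term a_i of a sequence is lookup a i.
label : ∀ {m} → Fin m → ℕ
label i = suc (toℕ i)

IsAreaSequence : ∀ {m} → Vec ℕ m → Set
IsAreaSequence {m} a =
    (∀ (i : Fin m) → lookup a i < label i)
  × (∀ (i i' : Fin m) → label i ≡ suc (label i') → lookup a i ≤ suc (lookup a i'))

module Graph {m : ℕ} (a : Vec ℕ m) where

  -- Edges {j , i} listed with their smaller endpoint first.
  Edge : Fin m → Fin m → Set
  Edge j i = label j < label i × label i ∸ lookup a i ≤ label j

  Adjacent : Fin m → Fin m → Set
  Adjacent u v = Edge u v ⊎ Edge v u

  Isolated : Fin m → Set
  Isolated v = ∀ u → ¬ Adjacent u v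

  -- {i , j + 1} and {i - 1 , j} are tested only when j + 1, respectively
  -- i - 1, is the label of a vertex.
  PeakPair : Fin m × Fin m → Set
  PeakPair (i , j) =
      Edge i j
    × (∀ j⁺ → label j⁺ ≡ suc (label j) → ¬ Edge i j⁺)
    × (∀ i⁻ → label i ≡ suc (label i⁻) → ¬ Edge i⁻ j)

  IsAbelian : Set
  IsAbelian = ∀ v → label v ≢ 1 → label v ≢ m →
              ∃[ u ] (label u ≡ 1 ⊎ label u ≡ m) × Adjacent u v

  edge? : ∀ j i → Dec (Edge j i)
  edge? j i = (label j <? label i) ×-dec (label i ∸ lookup a i ≤? label j)

  adjacent? : ∀ u v → Dec (Adjacent u v)
  adjacent? u v = edge? u v ⊎-dec edge? v u

  isolated? : ∀ v → Dec (Isolated v)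
  isolated? v = all? λ u → ¬? (adjacent? u v)

  peakPair? : ∀ e → Dec (PeakPair e)
  peakPair? (i , j) =
          edge? i j
    ×-dec all? (λ j⁺ → (label j⁺ ≟ suc (label j)) →-dec ¬? (edge? i j⁺))
    ×-dec all? (λ i⁻ → (label i ≟ suc (label i⁻)) →-dec ¬? (edge? i⁻ j))

  isAbelian? : Dec IsAbelian
  isAbelian? = all? λ v → ¬? (label v ≟ 1) →-dec (¬? (label v ≟ m) →-dec
    any? λ u → ((label u ≟ 1) ⊎-dec (label u ≟ m)) ×-dec adjacent? u v)

  -- The two lists count the two kinds of peak-edges: isolated vertices,
  -- and edges with the non-extension property.
  peak : ℕ
  peak = length (filter isolated? (allFin m))
       + length (filter peakPair? (cartesianProduct (allFin m) (allFin m)))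

open Graph public using (IsAbelian; peak)

IsAbelianAreaSequence : ∀ {m} → Vec ℕ m → Set
IsAbelianAreaSequence a = IsAreaSequence a × IsAbelian a

isAreaSequence? : ∀ {m} (a : Vec ℕ m) → Dec (IsAreaSequence a)
isAreaSequence? a =
        all? (λ i → lookup a i <? label i)
  ×-dec all? (λ i → all? λ i' →
          (label i ≟ suc (label i')) →-dec (lookup a i ≤? suc (lookup a i')))

isAbelianAreaSequence? : ∀ {m} (a : Vec ℕ m) → Dec (IsAbelianAreaSequence a)
isAbelianAreaSequence? a = isAreaSequence? a ×-dec Graph.isAbelian? a

vectors : {A : Set} → List A → ∀ m → List (Vec A m)
vectors xs zero    = Vec.[] ∷ []
vectors xs (suc m) = cartesianProductWith Vec._∷_ xs (vectors xs m)

-- The set 𝒜(m). Terms of an area sequence of size m are smaller than m, so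
-- the enumeration is exhaustive (∈-𝒜) and free of repetitions (𝒜-unique).
𝒜 : ∀ m → List (Vec ℕ m)
𝒜 m = filter isAbelianAreaSequence? (vectors (upTo m) m)

∈-vectors : ∀ {A : Set} {xs : List A} {m} (a : Vec A m) →
            (∀ i → lookup a i ∈ xs) → a ∈ vectors xs m
∈-vectors Vec.[]        h = here refl
∈-vectors (x Vec.∷ a) h = ∈-cartesianProductWith⁺ Vec._∷_
                            (h Fin.zero) (∈-vectors a (h ∘ Fin.suc))

vectors-unique : ∀ {A : Set} {xs : List A} → Unique xs →
                 ∀ m → Unique (vectors xs m)
vectors-unique u zero    = [] ∷ []
vectors-unique u (suc m) =
  Unique.cartesianProductWith⁺ Vec._∷_ ∷-injective u (vectors-unique u m)

label≤m : ∀ {m} (i : Fin m) → label i ≤ m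
label≤m Fin.zero    = s≤s z≤n
label≤m (Fin.suc i) = s≤s (label≤m i)

∈-𝒜 : ∀ {m} (a : Vec ℕ m) → a ∈ 𝒜 m ⇔ IsAbelianAreaSequence a
∈-𝒜 {m} a = mk⇔
  (λ a∈ → proj₂ (∈-filter⁻ isAbelianAreaSequence? {xs = vectors (upTo m) m} a∈))
  (λ { h@((a< , _) , _) → ∈-filter⁺ isAbelianAreaSequence?
         (∈-vectors a λ i → ∈-upTo⁺ (≤-trans (a< i) (label≤m i))) h })

𝒜-unique : ∀ m → Unique (𝒜 m)
𝒜-unique m =
  Unique.filter⁺ isAbelianAreaSequence? (vectors-unique (Unique.upTo⁺ m) m)

Peak : ℕ → Poly
Peak m = ∑ (map (λ a → X ^ᴾ peak a) (𝒜 m))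

------------------------------------------------------------------------
-- Dyck paths

data Step : Set where
  N E : Step

Path : Set
Path = List Step

#N #E : Path → ℕ
#N []      = 0
#N (N ∷ w) = suc (#N w)
#N (E ∷ w) = #N w
#E []      = 0
#E (N ∷ w) = #E w
#E (E ∷ w) = suc (#E w)

-- After an initial part u the path has reached the point (#E u , #N u).
record IsDyckPath (m : ℕ) (w : Path) : Set where
  field
    endpoint : #E w ≡ m × #N w ≡ m
    above    : ∀ u v → w ≡ u ++ v → #E u ≤ #N u

-- The i-th N step (the one preceded by i - 1 steps N) lies on the line
-- x = i - 1 - a_i, written without subtraction.
IsAreaSequenceOf : ∀ {m} → Vec ℕ m → Path → Set
IsAreaSequenceOf {m} a w =
  ∀ (i : Fin m) u v → w ≡ u ++ N ∷ v → suc (#N u) ≡ label i →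
  #E u + lookup a i ≡ #N u

record IsAbelianDyckPath (m : ℕ) (w : Path) : Set where
  field
    dyck         : IsDyckPath m w
    a            : Vec ℕ m
    areaSequence : IsAreaSequence a
    ofPath       : IsAreaSequenceOf a w
    abelian      : IsAbelian a

peaks : Path → ℕ
peaks (N ∷ E ∷ w) = suc (peaks (E ∷ w))
peaks (N ∷ N ∷ w) = peaks (N ∷ w)
peaks (E ∷ w)     = peaks w
peaks (N ∷ [])    = 0
peaks []          = 0

-- w is the path of semilength m denoted (k , L).
record IsPair (m : ℕ) (w : Path) (k : ℕ) (L : Path) : Set where
  field
    1≤k     : 1 ≤ k
    k≤m     : k ≤ m
    L-E     : #E L ≡ k
    L-N     : k + #N L ≡ m
    L-first : ∃[ L' ] L ≡ E ∷ L'
    word    : w ≡ replicate k N ++ L ++ replicate (m ∸ k) E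

-- The letters S_{2j-1} S_{2j} S_{2j+1} of S = S₁ S₂ ⋯, for j ≥ 1.
block : Path → ℕ → Path
block S j = take 3 (drop (2 * j ∸ 2) S)

NoForbiddenBlock : ℕ → Path → Set
NoForbiddenBlock n L = ∀ j → 1 ≤ j → j ≤ n →
    block (L ++ E ∷ []) j ≢ E ∷ N ∷ E ∷ []
  × block (L ++ E ∷ []) j ≢ N ∷ E ∷ N ∷ []

record IsCountedPath (n i : ℕ) (w : Path) : Set where
  field
    abelianDyck : IsAbelianDyckPath (2 * n) w
    i+1-peaks   : peaks w ≡ i + 1
    k           : ℕ
    L           : Path
    pair        : IsPair (2 * n) w k L
    noForbidden : NoForbiddenBlock n L

-- Exactly c elements of A satisfy P.
HasCardinality : {A : Set} → (A → Set) → ℕ → Set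
HasCardinality {A} P c =
  ∃[ xs ] Unique xs × (∀ (x : A) → x ∈ xs ⇔ P x) × length xs ≡ c

{-# OPTIONS --safe #-}
module Submission where

open import Algebra.Bundles using (CommutativeSemiring)
import Algebra.Solver.Ring.NaturalCoefficients.Default as SemiringSolver
open import Algebra.Structures using (IsCommutativeSemiring)
open import Data.Bool.Base using (Bool; if_then_else_)
open import Data.Fin.Base using (Fin; toℕ; fromℕ; fromℕ<; zero; suc)
open import Data.Fin.Properties using (toℕ-fromℕ<; toℕ-fromℕ; toℕ<n; toℕ-injective; toℕ≤pred[n]; all?)
open import Data.Integer.Base as ℤ using (ℤ; +_)
import Data.Integer.Properties as ℤ
import Data.Integer.Tactic.RingSolver as ℤ-Solver
open import Data.List.Base as List
  using (List; []; _∷_; _++_; map; length; filter; replicate; tabulate; allFin; applyUpTo; cartesianProduct)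
open import Data.List.Membership.Propositional using (_∈_)
open import Data.List.Membership.Propositional.Properties
  using ( ∈-filter⁺; ∈-filter⁻; ∈-map⁺; ∈-map⁻; ∈-++⁺ˡ; ∈-++⁺ʳ; ∈-++⁻
        ; ∈-allFin; ∈-cartesianProduct⁺)
open import Data.List.Membership.Propositional.Properties.WithK using (unique∧set⇒bag)
open import Data.List.Properties
  using ( map-upTo; length-map; length-++; length-tabulate; length-replicate; filter-accept; filter-reject
        ; ++-identityʳ; ++-cancelʳ; ∷-injectiveˡ; ∷-injectiveʳ)
open import Data.List.Relation.Binary.BagAndSetEquality using (∼bag⇒↭)
open import Data.List.Relation.Binary.Disjoint.Propositional using (Disjoint)
import Data.List.Relation.Binary.Permutation.Propositional as Perm
open import Data.List.Relation.Binary.Permutation.Propositional using (_↭_)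
open import Data.List.Relation.Binary.Permutation.Propositional.Properties using (↭-length)
open import Data.List.Relation.Unary.All as All using (All; []; _∷_)
import Data.List.Relation.Unary.All.Properties as All
open import Data.List.Relation.Unary.AllPairs using (AllPairs; []; _∷_)
import Data.List.Relation.Unary.AllPairs.Properties as AllPairs
open import Data.List.Relation.Unary.Any using (here; there)
open import Data.List.Relation.Unary.Unique.Propositional using (Unique)
import Data.List.Relation.Unary.Unique.Propositional.Properties as Unique
open import Data.Nat.Base
open import Data.Nat.Combinatorics using (_C_; k>n⇒nCk≡0; nCn≡1; nCk≡nC[n∸k]; nCk+nC[k+1]≡[n+1]C[k+1])
open import Data.Nat.Properties
import Data.Nat.Tactic.RingSolver as ℕ-Solver
open import Data.Product.Base using (∃-syntax; _×_; _,_; proj₁; proj₂)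
open import Data.Product.Properties using (,-injectiveʳ)
open import Data.Sum.Base using (_⊎_; inj₁; inj₂; [_,_]′)
open import Data.Vec.Base as Vec using (Vec; lookup; toList; fromList)
open import Data.Vec.Properties
  using ( lookup∘tabulate; tabulate∘lookup; tabulate-cong; length-toList; toList-injective; toList∘fromList
        ; cast-is-id)
open import Defs
open import Function.Base using (_∘_; case_of_)
open import Function.Bundles using (_⇔_; mk⇔; Equivalence)
open import Level using (0ℓ)
open import Relation.Binary.PropositionalEquality
import Relation.Binary.Reasoning.Setoid as SetoidReasoning
open import Relation.Nullary using (¬_; Dec; yes; no; contradiction)
open import Relation.Nullary.Decidable using (_×-dec_; _→-dec_; dec-true; dec-false)
open import Relation.Unary using (Decidable)

-- An Abelian Dyck path (k , L) of semilength m is determined by L = E w, where w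
-- is an arbitrary word of m - 1 letters. Its peak-edges correspond to the
-- distinct columns containing its N steps, so there is one more of them than
-- there are factors N E in w E. Hence Peak(t) / t enumerates the words E w E of
-- 2 n + 1 letters by their factors N E. Reading two letters at a time, the
-- transfer matrix for the letters in odd positions is
--   1 + t   2 t
--     2    1 + t
-- with eigenvalues (1 + t) ± 2 √t, and so Peak(t) / t is the even part in √t of
-- ((1 + t) + 2 √t)ⁿ; the binomial theorem is its gamma-expansion. Excluding the
-- blocks E N E and N E N replaces the diagonal entries by 1, which turns the
-- polynomial into the even part of (1 + 2 √t)ⁿ, the gamma-polynomial itself.

-- The commutative semiring of polynomials

-- No square root is adjoined. An element a + b s with s² = τ is carried as the pair (a , b), and
-- multiplication by u + 2 s is a recursion on such pairs. The transfer matrix is this recursion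
-- with u = 1 + t and τ = t, once the generating function of the words preceded by N is divided by
-- t. With u and τ arbitrary, one binomial expansion serves the gamma-expansion (u = 1 + t, τ = t),
-- the enumeration of the admissible words (u = 1, τ = t) and the closed form (u = 1, τ = t²).
--
-- Symmetry is seen in a different way. A word E w E of 2 n + 1 letters is determined by the places
-- where the letter changes: 2 i of the 2 n gaps are chosen, and i factors N E result. So the
-- coefficient of tⁱ in Peak(t) / t is the binomial coefficient of 2 n over 2 i.
--
-- The graph enters only through the columns i - 1 - a_i, which increase weakly. Being Abelian means
-- that no column exceeds the number of zero columns.

coeff-⊞ : ∀ p q k → coeff (p ⊞ q) k ≡ coeff p k ℤ.+ coeff q k
coeff-⊞ []      q       k       = sym (ℤ.+-identityˡ _)
coeff-⊞ (a ∷ p) []      k       = sym (ℤ.+-identityʳ _)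
coeff-⊞ (a ∷ p) (b ∷ q) zero    = refl
coeff-⊞ (a ∷ p) (b ∷ q) (suc k) = coeff-⊞ p q k

coeff-∙ : ∀ a p k → coeff (a ∙ p) k ≡ a ℤ.* coeff p k
coeff-∙ a []      k       = sym (ℤ.*-zeroʳ a)
coeff-∙ a (b ∷ p) zero    = refl
coeff-∙ a (b ∷ p) (suc k) = coeff-∙ a p k

coeff-⊠ : ∀ a p q k → coeff ((a ∷ p) ⊠ q) k ≡ a ℤ.* coeff q k ℤ.+ coeff (+ 0 ∷ p ⊠ q) k
coeff-⊠ a p q k = trans (coeff-⊞ (a ∙ q) (+ 0 ∷ p ⊠ q) k) (cong (ℤ._+ _) (coeff-∙ a q k))

infix 4 _≋_

-- A wrapper, because p and q cannot be inferred from the Π-type p ≈ q.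
record _≋_ (p q : Poly) : Set where
  constructor pointwise
  field
    at : p ≈ q

open _≋_ public

≋-refl : ∀ {p} → p ≋ p
≋-refl .at k = refl

≋-sym : ∀ {p q} → p ≋ q → q ≋ p
≋-sym e .at k = sym (at e k)

≋-trans : ∀ {p q r} → p ≋ q → q ≋ r → p ≋ r
≋-trans e f .at k = trans (at e k) (at f k)

⊞-cong : ∀ {p p′ q q′} → p ≋ p′ → q ≋ q′ → p ⊞ q ≋ p′ ⊞ q′
⊞-cong {p} {p′} {q} {q′} e f .at k =
  trans (coeff-⊞ p q k) (trans (cong₂ ℤ._+_ (at e k) (at f k)) (sym (coeff-⊞ p′ q′ k)))

∙-cong : ∀ a {p q} → p ≋ q → a ∙ p ≋ a ∙ q
∙-cong a {p} {q} e .at k =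
  trans (coeff-∙ a p k) (trans (cong (a ℤ.*_) (at e k)) (sym (coeff-∙ a q k)))

∷-cong : ∀ {a b p q} → a ≡ b → p ≋ q → (a ∷ p) ≋ (b ∷ q)
∷-cong e f .at zero    = e
∷-cong e f .at (suc k) = at f k

⊞-assoc : ∀ p q r → (p ⊞ q) ⊞ r ≋ p ⊞ (q ⊞ r)
⊞-assoc p q r .at k
  rewrite coeff-⊞ (p ⊞ q) r k | coeff-⊞ p q k | coeff-⊞ p (q ⊞ r) k | coeff-⊞ q r k
  = ℤ.+-assoc (coeff p k) _ _

⊞-comm : ∀ p q → p ⊞ q ≋ q ⊞ p
⊞-comm p q .at k rewrite coeff-⊞ p q k | coeff-⊞ q p k = ℤ.+-comm (coeff p k) _

⊞-identityʳ : ∀ p → p ⊞ [] ≋ p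
⊞-identityʳ p .at k = trans (coeff-⊞ p [] k) (ℤ.+-identityʳ _)

⊠-zeroʳ : ∀ p → p ⊠ [] ≋ []
⊠-zeroʳ []      .at k       = refl
⊠-zeroʳ (a ∷ p) .at zero    = refl
⊠-zeroʳ (a ∷ p) .at (suc k) = at (⊠-zeroʳ p) k

⊠-congˡ : ∀ p {q r} → q ≋ r → p ⊠ q ≋ p ⊠ r
⊠-congˡ []      e = ≋-refl
⊠-congˡ (a ∷ p) e = ⊞-cong (∙-cong a e) (∷-cong refl (⊠-congˡ p e))

-- The product recurses on its left factor; this is the mirrored recursion on the right factor, from
-- which commutativity follows by induction.
⊠-∷ : ∀ p b q → p ⊠ (b ∷ q) ≋ b ∙ p ⊞ (+ 0 ∷ p ⊠ q)
⊠-∷ []      b q .at zero    = refl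
⊠-∷ []      b q .at (suc k) = refl
⊠-∷ (a ∷ p) b q .at zero    = cong (ℤ._+ + 0) (ℤ.*-comm a b)
⊠-∷ (a ∷ p) b q .at (suc k)
  rewrite coeff-⊞ (a ∙ q) (p ⊠ (b ∷ q)) k | coeff-⊞ (b ∙ p) ((a ∷ p) ⊠ q) k
        | at (⊠-∷ p b q) k | coeff-⊞ (b ∙ p) (+ 0 ∷ p ⊠ q) k | coeff-⊞ (a ∙ q) (+ 0 ∷ p ⊠ q) k
  = shuffle (coeff (a ∙ q) k) (coeff (b ∙ p) k) (coeff (+ 0 ∷ p ⊠ q) k)
  where
  shuffle : ∀ x y z → x ℤ.+ (y ℤ.+ z) ≡ y ℤ.+ (x ℤ.+ z)
  shuffle = ℤ-Solver.solve-∀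

⊠-comm : ∀ p q → p ⊠ q ≋ q ⊠ p
⊠-comm []      q = ≋-sym (⊠-zeroʳ q)
⊠-comm (a ∷ p) q = ≋-trans (⊞-cong ≋-refl (∷-cong refl (⊠-comm p q))) (≋-sym (⊠-∷ q a p))

-- Equal polynomials may be lists of different lengths, which hinders induction on the left factor.
-- Commutativity moves each factor to the right, where `⊠-congˡ` applies.
⊠-cong : ∀ {p p′ q q′} → p ≋ p′ → q ≋ q′ → p ⊠ q ≋ p′ ⊠ q′
⊠-cong {p} {p′} {q} {q′} e f =
  ≋-trans (⊠-congˡ p f) (≋-trans (⊠-comm p q′) (≋-trans (⊠-congˡ q′ e) (⊠-comm q′ p′)))

⊠-distribˡ : ∀ p q r → p ⊠ (q ⊞ r) ≋ p ⊠ q ⊞ p ⊠ r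
⊠-distribˡ []      q r .at k = refl
⊠-distribˡ (a ∷ p) q r .at k
  rewrite coeff-⊠ a p (q ⊞ r) k | coeff-⊞ q r k | coeff-⊞ ((a ∷ p) ⊠ q) ((a ∷ p) ⊠ r) k
        | coeff-⊠ a p q k | coeff-⊠ a p r k
  = trans (cong (λ z → a ℤ.* (coeff q k ℤ.+ coeff r k) ℤ.+ z)
            (trans (at (∷-cong {+ 0} refl (⊠-distribˡ p q r)) k)
                   (coeff-⊞ (+ 0 ∷ p ⊠ q) (+ 0 ∷ p ⊠ r) k)))
          (shuffle a (coeff q k) (coeff r k) (coeff (+ 0 ∷ p ⊠ q) k) (coeff (+ 0 ∷ p ⊠ r) k))
  where
  shuffle : ∀ a x y z w → a ℤ.* (x ℤ.+ y) ℤ.+ (z ℤ.+ w) ≡ (a ℤ.* x ℤ.+ z) ℤ.+ (a ℤ.* y ℤ.+ w)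
  shuffle = ℤ-Solver.solve-∀

⊠-distribʳ : ∀ p q r → (q ⊞ r) ⊠ p ≋ q ⊠ p ⊞ r ⊠ p
⊠-distribʳ p q r = ≋-trans (⊠-comm (q ⊞ r) p)
  (≋-trans (⊠-distribˡ p q r) (⊞-cong (⊠-comm p q) (⊠-comm p r)))

∙-⊠ : ∀ a p q → (a ∙ p) ⊠ q ≋ a ∙ (p ⊠ q)
∙-⊠ a []      q .at k = refl
∙-⊠ a (b ∷ p) q .at k
  rewrite coeff-⊠ (a ℤ.* b) (a ∙ p) q k | coeff-∙ a ((b ∷ p) ⊠ q) k | coeff-⊠ b p q k
  = trans (cong (λ z → a ℤ.* b ℤ.* coeff q k ℤ.+ z)
            (trans (at (∷-cong (sym (ℤ.*-zeroʳ a)) (∙-⊠ a p q)) k) (coeff-∙ a (+ 0 ∷ p ⊠ q) k)))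
          (shuffle a b (coeff q k) (coeff (+ 0 ∷ p ⊠ q) k))
  where
  shuffle : ∀ a b x y → (a ℤ.* b) ℤ.* x ℤ.+ a ℤ.* y ≡ a ℤ.* (b ℤ.* x ℤ.+ y)
  shuffle = ℤ-Solver.solve-∀

0∷-⊠ : ∀ p q → (+ 0 ∷ p) ⊠ q ≋ (+ 0 ∷ p ⊠ q)
0∷-⊠ p q .at k = trans (coeff-⊠ (+ 0) p q k) (ℤ.+-identityˡ _)

⊠-assoc : ∀ p q r → (p ⊠ q) ⊠ r ≋ p ⊠ (q ⊠ r)
⊠-assoc []      q r = ≋-refl
⊠-assoc (a ∷ p) q r = ≋-trans (⊠-distribʳ r (a ∙ q) (+ 0 ∷ p ⊠ q))
  (⊞-cong (∙-⊠ a q r) (≋-trans (0∷-⊠ (p ⊠ q) r) (∷-cong refl (⊠-assoc p q r))))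

⊠-identityˡ : ∀ p → 𝟙 ⊠ p ≋ p
⊠-identityˡ p .at k = trans (coeff-⊠ (+ 1) [] p k)
  (trans (cong (λ z → (+ 1) ℤ.* coeff p k ℤ.+ z) (coeff-0∷[] k)) (trans (ℤ.+-identityʳ _) (ℤ.*-identityˡ _)))
  where
  coeff-0∷[] : ∀ k → coeff (+ 0 ∷ []) k ≡ + 0
  coeff-0∷[] zero    = refl
  coeff-0∷[] (suc k) = refl

X-⊠ : ∀ p → X ⊠ p ≋ (+ 0 ∷ p)
X-⊠ p = ≋-trans (0∷-⊠ 𝟙 p) (∷-cong refl (⊠-identityˡ p))

poly-isCommutativeSemiring : IsCommutativeSemiring _≋_ _⊞_ _⊠_ [] 𝟙
poly-isCommutativeSemiring = record
  { isSemiring = record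
    { isSemiringWithoutAnnihilatingZero = record
      { +-isCommutativeMonoid = record
        { isMonoid = record
          { isSemigroup = record
            { isMagma = record
              { isEquivalence = record { refl = ≋-refl ; sym = ≋-sym ; trans = ≋-trans }
              ; ∙-cong = ⊞-cong }
            ; assoc = ⊞-assoc }
          ; identity = (λ _ → ≋-refl) , ⊞-identityʳ }
        ; comm = ⊞-comm }
      ; *-cong = ⊠-cong
      ; *-assoc = ⊠-assoc
      ; *-identity = ⊠-identityˡ , λ p → ≋-trans (⊠-comm p 𝟙) (⊠-identityˡ p)
      ; distrib = ⊠-distribˡ , ⊠-distribʳ }
    ; zero = (λ _ → ≋-refl) , ⊠-zeroʳ }
  ; *-comm = ⊠-comm }

polySemiring : CommutativeSemiring 0ℓ 0ℓ
polySemiring = record { isCommutativeSemiring = poly-isCommutativeSemiring }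

module ≋-Reasoning = SetoidReasoning (CommutativeSemiring.setoid polySemiring)
module PolySolver = SemiringSolver polySemiring

-- Even and odd parts of (u + 2 √τ)ⁿ

≡⇒≋ : ∀ {p q} → p ≡ q → p ≋ q
≡⇒≋ refl = ≋-refl

∑-cong : ∀ {f g : ℕ → Poly} → (∀ i → f i ≋ g i) → ∀ k → ∑ (applyUpTo f k) ≋ ∑ (applyUpTo g k)
∑-cong e zero    = ≋-refl
∑-cong e (suc k) = ⊞-cong (e 0) (∑-cong (e ∘ suc) k)

∑-⊞ : ∀ f g k → ∑ (applyUpTo (λ i → f i ⊞ g i) k) ≋ ∑ (applyUpTo f k) ⊞ ∑ (applyUpTo g k)
∑-⊞ f g zero    = ≋-refl
∑-⊞ f g (suc k) = ≋-trans (⊞-cong ≋-refl (∑-⊞ (f ∘ suc) (g ∘ suc) k))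
  (solve 4 (λ a b c d → (a :+ b) :+ (c :+ d) := (a :+ c) :+ (b :+ d)) ≋-refl
     (f 0) (g 0) (∑ (applyUpTo (f ∘ suc) k)) (∑ (applyUpTo (g ∘ suc) k)))
  where open PolySolver

∑-⊠ : ∀ p f k → ∑ (applyUpTo (λ i → p ⊠ f i) k) ≋ p ⊠ ∑ (applyUpTo f k)
∑-⊠ p f zero    = ≋-sym (⊠-zeroʳ p)
∑-⊠ p f (suc k) = ≋-trans (⊞-cong ≋-refl (∑-⊠ p (f ∘ suc) k)) (≋-sym (⊠-distribˡ p _ _))

∑-zero : ∀ f k → (∀ i → f i ≋ []) → ∑ (applyUpTo f k) ≋ []
∑-zero f zero    e = ≋-refl
∑-zero f (suc k) e = ⊞-cong (e 0) (∑-zero (f ∘ suc) k (e ∘ suc))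

-- Used to adjust the number of summands: the expansions of the even and odd parts are cut off at
-- different places, and all surplus terms vanish.
∑-extend : ∀ f {j k} → j ≤ k → (∀ i → j ≤ i → f i ≋ []) →
           ∑ (applyUpTo f j) ≋ ∑ (applyUpTo f k)
∑-extend f {k = k} z≤n e = ≋-sym (∑-zero f k (λ i → e i z≤n))
∑-extend f (s≤s j≤k)   e = ⊞-cong ≋-refl (∑-extend (f ∘ suc) j≤k (λ i → e (suc i) ∘ s≤s))

∑[0⋯]-applyUpTo : ∀ f k → ∑[0⋯ k ] f ≡ ∑ (applyUpTo f (suc k))
∑[0⋯]-applyUpTo f k = cong ∑ (map-upTo f (suc k))

∑[0⋯]-cong : ∀ {f g : ℕ → Poly} k → (∀ i → f i ≋ g i) → ∑[0⋯ k ] f ≋ ∑[0⋯ k ] g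
∑[0⋯]-cong {f} {g} k e = ≋-trans (≡⇒≋ (∑[0⋯]-applyUpTo f k))
  (≋-trans (∑-cong e (suc k)) (≡⇒≋ (sym (∑[0⋯]-applyUpTo g k))))

∙-zero : ∀ p → (+ 0) ∙ p ≋ []
∙-zero p .at k = coeff-∙ (+ 0) p k

∙-distribʳ : ∀ a b p → (+ (a + b)) ∙ p ≋ (+ a) ∙ p ⊞ (+ b) ∙ p
∙-distribʳ a b p .at k
  rewrite coeff-⊞ ((+ a) ∙ p) ((+ b) ∙ p) k | coeff-∙ (+ (a + b)) p k
        | coeff-∙ (+ a) p k | coeff-∙ (+ b) p k
  = ℤ.*-distribʳ-+ (coeff p k) (+ a) (+ b)

⊠-∙ : ∀ a p q → p ⊠ (a ∙ q) ≋ a ∙ (p ⊠ q)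
⊠-∙ a p q = ≋-trans (⊠-comm p (a ∙ q)) (≋-trans (∙-⊠ a q p) (∙-cong a (⊠-comm q p)))

-- even u τ n and odd u τ n are the coefficients of 1 and s in (u + 2 s)ⁿ,
-- where s is a square root of τ.
even odd : Poly → Poly → ℕ → Poly
even u τ zero    = 𝟙
even u τ (suc n) = u ⊠ even u τ n ⊞ τ ⊠ (odd u τ n ⊞ odd u τ n)
odd  u τ zero    = []
odd  u τ (suc n) = u ⊠ odd u τ n ⊞ (even u τ n ⊞ even u τ n)

-- Multiplying a + s b by u + 2 s and replacing s² by τ is exactly the recursion of `even` and
-- `odd`. Both roots s and -s of τ are allowed, so adding the two instances cancels the odd part.
power-split : ∀ u τ s → s ⊠ s ≋ τ → ∀ n →
              even u τ n ⊞ s ⊠ odd u τ n ≋ (u ⊞ (s ⊞ s)) ^ᴾ n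
power-split u τ s e zero    = ≋-trans (⊞-cong ≋-refl (⊠-zeroʳ s)) (⊞-identityʳ 𝟙)
power-split u τ s e (suc n) = begin
  (u ⊠ a ⊞ τ ⊠ (b ⊞ b)) ⊞ s ⊠ (u ⊠ b ⊞ (a ⊞ a))
    ≈⟨ ⊞-cong (⊞-cong (≋-refl {u ⊠ a}) (⊠-cong (≋-sym e) ≋-refl)) ≋-refl ⟩
  (u ⊠ a ⊞ (s ⊠ s) ⊠ (b ⊞ b)) ⊞ s ⊠ (u ⊠ b ⊞ (a ⊞ a))
    ≈⟨ solve 4 (λ u s a b → (u :* a :+ (s :* s) :* (b :+ b)) :+ s :* (u :* b :+ (a :+ a))
                         := (u :+ (s :+ s)) :* (a :+ s :* b)) ≋-refl u s a b ⟩
  (u ⊞ (s ⊞ s)) ⊠ (a ⊞ s ⊠ b)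
    ≈⟨ ⊠-congˡ (u ⊞ (s ⊞ s)) (power-split u τ s e n) ⟩
  (u ⊞ (s ⊞ s)) ^ᴾ suc n ∎
  where
  open ≋-Reasoning
  open PolySolver
  a = even u τ n
  b = odd u τ n

-- The coefficient of uⁿ⁻ʲ sʲ in (u + 2 s)ⁿ.
weight : ℕ → ℕ → ℕ
weight n j = 2 ^ j * (n C j)

weight-suc : ∀ n j → weight (suc n) (suc j) ≡ weight n (suc j) + (weight n j + weight n j)
weight-suc n j rewrite sym (nCk+nC[k+1]≡[n+1]C[k+1] n j) = shuffle (2 ^ j) (n C j) (n C suc j)
  where
  shuffle : ∀ p x y → (p + (p + 0)) * (x + y) ≡ (p + (p + 0)) * y + (p * x + p * x)
  shuffle = ℕ-Solver.solve-∀

weight-vanishes : ∀ {n j} → n < j → weight n j ≡ 0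
weight-vanishes {n} {j} n<j = trans (cong (2 ^ j *_) (k>n⇒nCk≡0 n<j)) (*-zeroʳ (2 ^ j))

-- The j-th binomial summand of (u + 2 s)ⁿ with σ in place of sʲ. It is used with σ = τⁱ both for j
-- = 2 i and for j = 2 i + 1; in the odd case one factor s is split off.
term : (u σ : Poly) → ℕ → ℕ → Poly
term u σ n j = (+ weight n j) ∙ (σ ⊠ u ^ᴾ (n ∸ j))

term-vanishes : ∀ u σ {n j} → n < j → term u σ n j ≋ []
term-vanishes u σ {n} {j} n<j rewrite weight-vanishes n<j = ∙-zero _

term-zero : ∀ u σ n → term u σ (suc n) 0 ≋ u ⊠ term u σ n 0
term-zero u σ n = ≋-trans
  (∙-cong (+ 1) (solve 3 (λ σ u v → σ :* (u :* v) := u :* (σ :* v)) ≋-refl σ u (u ^ᴾ n)))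
  (≋-sym (⊠-∙ (+ 1) u _))
  where open PolySolver

term-suc : ∀ u σ n j → term u σ (suc n) (suc j) ≋
           u ⊠ term u σ n (suc j) ⊞ (term u σ n j ⊞ term u σ n j)
term-suc u σ n j = begin
  (+ weight (suc n) (suc j)) ∙ q
    ≡⟨ cong (λ c → (+ c) ∙ q) (weight-suc n j) ⟩
  (+ (weight n (suc j) + (weight n j + weight n j))) ∙ q
    ≈⟨ ∙-distribʳ (weight n (suc j)) _ q ⟩
  (+ weight n (suc j)) ∙ q ⊞ (+ (weight n j + weight n j)) ∙ q
    ≈⟨ ⊞-cong lower (∙-distribʳ (weight n j) _ q) ⟩
  u ⊠ term u σ n (suc j) ⊞ (term u σ n j ⊞ term u σ n j) ∎
  where
  open ≋-Reasoning
  open PolySolver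
  q = σ ⊠ u ^ᴾ (n ∸ j)
  lower : (+ weight n (suc j)) ∙ q ≋ u ⊠ term u σ n (suc j)
  -- Truncated subtraction gives n ∸ j = 1 + (n ∸ (j + 1)) only for j < n; otherwise the weight is 0
  -- and both sides vanish.
  lower with suc j ≤? n
  ... | no  j≮n rewrite weight-vanishes {n} {suc j} (≰⇒> j≮n) =
    ≋-trans (∙-zero q) (≋-sym (≋-trans (⊠-congˡ u (∙-zero _)) (⊠-zeroʳ u)))
  ... | yes j<n rewrite +-∸-assoc 1 j<n = ≋-trans
    (∙-cong c (solve 3 (λ σ u v → σ :* (u :* v) := u :* (σ :* v)) ≋-refl σ u (u ^ᴾ (n ∸ suc j))))
    (≋-sym (⊠-∙ c u _))
    where c = + weight n (suc j)

⊠-term : ∀ p u σ n j → term u (p ⊠ σ) n j ≋ p ⊠ term u σ n j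
⊠-term p u σ n j = ≋-trans (∙-cong (+ weight n j) (⊠-assoc p σ _)) (≋-sym (⊠-∙ (+ weight n j) p _))

2*suc : ∀ i → 2 * suc i ≡ suc (suc (2 * i))
2*suc i = cong suc (+-suc i (i + 0))

-- The bound n < 2 k makes both sums complete, and a free k can stay fixed during the induction on
-- n. The even sum has one summand more: apart from its summand 0, each even index 2 i + 2 is paired
-- with the odd index 2 i + 1.
even-odd-expansion : ∀ u τ n k → n < 2 * k →
    even u τ n ≋ ∑ (applyUpTo (λ i → term u (τ ^ᴾ i) n (2 * i)) (suc k))
  × odd  u τ n ≋ ∑ (applyUpTo (λ i → term u (τ ^ᴾ i) n (suc (2 * i))) k)
even-odd-expansion u τ zero k _ =
    ≋-sym (≋-trans (⊞-cong base (∑-zero _ k λ i →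
        term-vanishes u (τ ^ᴾ suc i) {0} {2 * suc i} (subst (0 <_) (sym (2*suc i)) z<s)))
      (⊞-identityʳ 𝟙))
  , ≋-sym (∑-zero _ k λ i → term-vanishes u (τ ^ᴾ i) {0} {suc (2 * i)} z<s)
  where
  base : term u 𝟙 0 0 ≋ 𝟙
  base .at zero          = refl
  base .at (suc zero)    = refl
  base .at (suc (suc k)) = refl
even-odd-expansion u τ (suc n) k sn<2k = evens , odds
  where
  open ≋-Reasoning
  n<2k : n < 2 * k
  n<2k = <-trans (n<1+n n) sn<2k
  e o : ℕ → Poly
  e i = term u (τ ^ᴾ i) n (2 * i)
  o i = term u (τ ^ᴾ i) n (suc (2 * i))
  IH = even-odd-expansion u τ n k n<2k

  step : ∀ i → term u (τ ^ᴾ suc i) (suc n) (2 * suc i) ≋ u ⊠ e (suc i) ⊞ τ ⊠ (o i ⊞ o i)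
  step i = subst
    (λ j → term u (τ ^ᴾ suc i) (suc n) j ≋ u ⊠ term u (τ ^ᴾ suc i) n j ⊞ τ ⊠ (o i ⊞ o i))
    (sym (2*suc i)) (≋-trans (term-suc u (τ ^ᴾ suc i) n (suc (2 * i)))
    (⊞-cong ≋-refl (≋-trans (⊞-cong d d) (≋-sym (⊠-distribˡ τ _ _)))))
    where d = ⊠-term τ u (τ ^ᴾ i) n (suc (2 * i))

  evens : even u τ (suc n) ≋ ∑ (applyUpTo (λ i → term u (τ ^ᴾ i) (suc n) (2 * i)) (suc k))
  evens = begin
    u ⊠ even u τ n ⊞ τ ⊠ (odd u τ n ⊞ odd u τ n)
      ≈⟨ ⊞-cong (⊠-congˡ u (proj₁ IH)) (⊠-congˡ τ (⊞-cong (proj₂ IH) (proj₂ IH))) ⟩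
    u ⊠ (e 0 ⊞ ∑ (applyUpTo (e ∘ suc) k)) ⊞ τ ⊠ (∑ (applyUpTo o k) ⊞ ∑ (applyUpTo o k))
      ≈⟨ solve 5 (λ u a b t c → u :* (a :+ b) :+ t :* c := u :* a :+ (u :* b :+ t :* c)) ≋-refl
           u (e 0) (∑ (applyUpTo (e ∘ suc) k)) τ _ ⟩
    u ⊠ e 0 ⊞ (u ⊠ ∑ (applyUpTo (e ∘ suc) k) ⊞ τ ⊠ (∑ (applyUpTo o k) ⊞ ∑ (applyUpTo o k)))
      ≈⟨ ⊞-cong (≋-sym (term-zero u 𝟙 n)) (≋-sym rest) ⟩
    term u 𝟙 (suc n) 0 ⊞ ∑ (applyUpTo (λ i → term u (τ ^ᴾ suc i) (suc n) (2 * suc i)) k) ∎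
    where
    open PolySolver
    rest = ≋-trans (∑-cong step k) (≋-trans (∑-⊞ _ _ k)
      (⊞-cong (∑-⊠ u (e ∘ suc) k) (≋-trans (∑-⊠ τ _ k) (⊠-congˡ τ (∑-⊞ o o k)))))

  odds : odd u τ (suc n) ≋ ∑ (applyUpTo (λ i → term u (τ ^ᴾ i) (suc n) (suc (2 * i))) k)
  odds = ≋-sym (≋-trans (∑-cong (λ i → term-suc u (τ ^ᴾ i) n (2 * i)) k)
    (≋-trans (∑-⊞ _ _ k) (⊞-cong
      (≋-trans (∑-⊠ u o k) (⊠-congˡ u (≋-sym (proj₂ IH))))
      (≋-trans (∑-⊞ e e k) (⊞-cong trim trim)))))
    where
    -- The odd sum has only k summands; the even summand missing here has index 2 k > n and is zero.
    trim : ∑ (applyUpTo e k) ≋ even u τ n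
    trim = ≋-trans (∑-extend e (n≤1+n k) λ i k≤i →
                      term-vanishes u (τ ^ᴾ i) {n} {2 * i} (<-≤-trans n<2k (*-monoʳ-≤ 2 k≤i)))
                   (≋-sym (proj₁ IH))

n<2*1+⌊n/2⌋ : ∀ n → n < 2 * suc ⌊ n /2⌋
n<2*1+⌊n/2⌋ zero          = s≤s z≤n
n<2*1+⌊n/2⌋ (suc zero)    = s≤s (s≤s z≤n)
n<2*1+⌊n/2⌋ (suc (suc n)) = subst (suc (suc n) <_) (sym (2*suc (suc ⌊ n /2⌋))) (s<s (s<s (n<2*1+⌊n/2⌋ n)))

even-expansion : ∀ u τ n → even u τ n ≋ ∑[0⋯ ⌊ n /2⌋ ] λ i → term u (τ ^ᴾ i) n (2 * i)
even-expansion u τ n = ≋-trans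
  (proj₁ (even-odd-expansion u τ n (suc ⌊ n /2⌋) (n<2*1+⌊n/2⌋ n)))
  (≋-trans (≋-sym (∑-extend (λ i → term u (τ ^ᴾ i) n (2 * i)) (n≤1+n (suc ⌊ n /2⌋)) λ i h<i →
              term-vanishes u (τ ^ᴾ i) {n} {2 * i} (<-≤-trans (n<2*1+⌊n/2⌋ n) (*-monoʳ-≤ 2 h<i))))
           (≡⇒≋ (sym (∑[0⋯]-applyUpTo _ ⌊ n /2⌋))))

-- Peak generating functions

genFun : {A : Set} → (A → ℕ) → List A → Poly
genFun f xs = ∑ (map (λ x → X ^ᴾ f x) xs)

genFun-++ : ∀ {A : Set} (f : A → ℕ) xs ys → genFun f (xs ++ ys) ≋ genFun f xs ⊞ genFun f ys
genFun-++ f []       ys = ≋-refl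
genFun-++ f (x ∷ xs) ys = ≋-trans (⊞-cong ≋-refl (genFun-++ f xs ys)) (≋-sym (⊞-assoc (X ^ᴾ f x) _ _))

genFun-map : ∀ {A B : Set} (f : B → ℕ) (g : A → B) xs → genFun f (map g xs) ≡ genFun (f ∘ g) xs
genFun-map f g []       = refl
genFun-map f g (x ∷ xs) = cong (X ^ᴾ f (g x) ⊞_) (genFun-map f g xs)

genFun-cong : ∀ {A : Set} {f g : A → ℕ} {xs} → All (λ x → f x ≡ g x) xs → genFun f xs ≡ genFun g xs
genFun-cong []       = refl
genFun-cong (e ∷ es) = cong₂ (λ i q → X ^ᴾ i ⊞ q) e (genFun-cong es)

genFun-suc : ∀ {A : Set} (f : A → ℕ) xs → genFun (suc ∘ f) xs ≋ X ⊠ genFun f xs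
genFun-suc f []       = ≋-sym (⊠-zeroʳ X)
genFun-suc f (x ∷ xs) = ≋-trans (⊞-cong ≋-refl (genFun-suc f xs)) (≋-sym (⊠-distribˡ X (X ^ᴾ f x) (genFun f xs)))

genFun-↭ : ∀ {A : Set} (f : A → ℕ) {xs ys} → xs ↭ ys → genFun f xs ≋ genFun f ys
genFun-↭ f Perm.refl         = ≋-refl
genFun-↭ f (Perm.prep x p)   = ⊞-cong ≋-refl (genFun-↭ f p)
genFun-↭ f (Perm.swap {xs} {ys} x y p) = ≋-trans
  (⊞-cong (≋-refl {X ^ᴾ f x}) (⊞-cong (≋-refl {X ^ᴾ f y}) (genFun-↭ f p)))
  (solve 3 (λ a b c → a :+ (b :+ c) := b :+ (a :+ c)) ≋-refl (X ^ᴾ f x) (X ^ᴾ f y) (genFun f ys))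
  where open PolySolver
genFun-↭ f (Perm.trans p q) = ≋-trans (genFun-↭ f p) (genFun-↭ f q)

coeff-X^ : ∀ j → coeff (X ^ᴾ j) j ≡ + 1
coeff-X^ zero    = refl
coeff-X^ (suc j) = trans (at (X-⊠ (X ^ᴾ j)) (suc j)) (coeff-X^ j)

coeff-X^-≢ : ∀ {j k} → j ≢ k → coeff (X ^ᴾ j) k ≡ + 0
coeff-X^-≢ {zero}  {zero}  j≢k = contradiction refl j≢k
coeff-X^-≢ {zero}  {suc k} j≢k = refl
coeff-X^-≢ {suc j} {zero}  j≢k = at (X-⊠ (X ^ᴾ j)) 0
coeff-X^-≢ {suc j} {suc k} j≢k = trans (at (X-⊠ (X ^ᴾ j)) (suc k)) (coeff-X^-≢ (j≢k ∘ cong suc))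

-- Converts an identity between generating functions into a cardinality.
coeff-genFun : ∀ {A : Set} (f : A → ℕ) xs k →
               coeff (genFun f xs) k ≡ + length (filter (λ x → f x ≟ k) xs)
coeff-genFun f []       k = refl
coeff-genFun f (x ∷ xs) k with f x ≟ k
... | yes fx≡k = begin
  coeff (X ^ᴾ f x ⊞ genFun f xs) k
    ≡⟨ coeff-⊞ (X ^ᴾ f x) (genFun f xs) k ⟩
  coeff (X ^ᴾ f x) k ℤ.+ coeff (genFun f xs) k
    ≡⟨ cong₂ ℤ._+_ (subst (λ j → coeff (X ^ᴾ f x) j ≡ + 1) fx≡k (coeff-X^ (f x))) (coeff-genFun f xs k) ⟩
  + length (x ∷ filter (λ x → f x ≟ k) xs)
    ≡⟨ cong (+_ ∘ length) (filter-accept (λ x → f x ≟ k) fx≡k) ⟨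
  + length (filter (λ x → f x ≟ k) (x ∷ xs)) ∎
  where open ≡-Reasoning
... | no  fx≢k = begin
  coeff (X ^ᴾ f x ⊞ genFun f xs) k
    ≡⟨ coeff-⊞ (X ^ᴾ f x) (genFun f xs) k ⟩
  coeff (X ^ᴾ f x) k ℤ.+ coeff (genFun f xs) k
    ≡⟨ cong₂ ℤ._+_ (coeff-X^-≢ fx≢k) (coeff-genFun f xs k) ⟩
  + length (filter (λ x → f x ≟ k) xs)
    ≡⟨ cong (+_ ∘ length) (filter-reject (λ x → f x ≟ k) fx≢k) ⟨
  + length (filter (λ x → f x ≟ k) (x ∷ xs)) ∎
  where open ≡-Reasoning

-- afterE (1 + r) and afterN (1 + r) enumerate the r-letter words w by the peaks
-- of w E and of N w E; the recursion reads the first letter of w.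
afterE afterN : ℕ → Poly
afterE zero    = 𝟙
afterE (suc r) = afterE r ⊞ afterN r
afterN zero    = []
afterN (suc r) = X ⊠ afterE r ⊞ afterN r

words : ∀ r → List (Vec Step r)
words = vectors (E ∷ N ∷ [])

genFun-words : ∀ r (f : Vec Step (suc r) → ℕ) →
  genFun f (words (suc r)) ≋ genFun (f ∘ (E Vec.∷_)) (words r) ⊞ genFun (f ∘ (N Vec.∷_)) (words r)
genFun-words r f
  rewrite ++-identityʳ (map (N Vec.∷_) (words r))
        | sym (genFun-map f (E Vec.∷_) (words r))
        | sym (genFun-map f (N Vec.∷_) (words r))
  = genFun-++ f (map (E Vec.∷_) (words r)) (map (N Vec.∷_) (words r))

peaksE peaksN : Path → ℕ
peaksE w = peaks (w ++ E ∷ [])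
peaksN w = peaks (N ∷ w ++ E ∷ [])

-- Prefixing E to E or N changes no peak count, nor does prefixing N to N; only the prefix N E
-- creates a peak, which gives the single factor X in `afterN`.
genFun-peaks : ∀ r →
    genFun (peaksE ∘ toList) (words r) ≋ afterE (suc r)
  × genFun (peaksN ∘ toList) (words r) ≋ afterN (suc r)
genFun-peaks zero    = ≋-refl , ≋-refl
genFun-peaks (suc r) =
    ≋-trans (genFun-words r (peaksE ∘ toList)) (⊞-cong ihE ihN)
  , ≋-trans (genFun-words r (peaksN ∘ toList)) (⊞-cong (≋-trans (genFun-suc (peaksE ∘ toList) (words r)) (⊠-congˡ X ihE)) ihN)
  where
  ihE = proj₁ (genFun-peaks r)
  ihN = proj₂ (genFun-peaks r)

-- A word of r + 1 letters with prescribed first letter is given by the gaps, out of r, at which the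
-- letter changes. From E to E there are 2 i changes and i factors N E; from N to E there are 2 i +
-- 1 changes and i + 1 factors N E. The induction itself is Pascal's rule.
coeff-after : ∀ r i →
    coeff (afterE r) i ≡ + (r C (2 * i))
  × coeff (afterN r) (suc i) ≡ + (r C suc (2 * i))
  × coeff (afterN r) 0 ≡ + 0
coeff-after zero zero    = refl , refl , refl
coeff-after zero (suc i) = cong +_ (sym (k>n⇒nCk≡0 {0} {2 * suc i} z<s))
                          , cong +_ (sym (k>n⇒nCk≡0 {0} {suc (2 * suc i)} z<s))
                          , refl
coeff-after (suc r) i = cE i , cN , c0
  where
  c0 : coeff (afterN (suc r)) 0 ≡ + 0
  c0 rewrite coeff-⊞ (X ⊠ afterE r) (afterN r) 0 | at (X-⊠ (afterE r)) 0
           | proj₂ (proj₂ (coeff-after r i)) = refl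
  cN : coeff (afterN (suc r)) (suc i) ≡ + (suc r C suc (2 * i))
  cN rewrite coeff-⊞ (X ⊠ afterE r) (afterN r) (suc i) | at (X-⊠ (afterE r)) (suc i)
           | proj₁ (coeff-after r i) | proj₁ (proj₂ (coeff-after r i))
    = cong +_ (nCk+nC[k+1]≡[n+1]C[k+1] r (2 * i))
  cE : ∀ i → coeff (afterE (suc r)) i ≡ + (suc r C (2 * i))
  cE zero rewrite coeff-⊞ (afterE r) (afterN r) 0
    | proj₁ (coeff-after r 0) | proj₂ (proj₂ (coeff-after r 0)) = refl
  cE (suc i) = trans (coeff-⊞ (afterE r) (afterN r) (suc i))
    (trans (cong₂ ℤ._+_ (proj₁ (coeff-after r (suc i))) (proj₁ (proj₂ (coeff-after r i))))
    (cong +_ (trans (cong (λ j → r C j + r C suc (2 * i)) (2*suc i))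
      (trans (+-comm (r C suc (suc (2 * i))) _)
      (trans (nCk+nC[k+1]≡[n+1]C[k+1] r (suc (2 * i))) (cong (suc r C_) (sym (2*suc i))))))))

-- Reading a word two letters at a time.
after-even : ∀ n → afterE (2 * n) ≋ even (𝟙 ⊞ X) X n × afterN (2 * n) ≋ X ⊠ odd (𝟙 ⊞ X) X n
after-even zero    = ≋-refl , ≋-sym (⊠-zeroʳ X)
after-even (suc n) = ≋-trans (≡⇒≋ (cong afterE (2*suc n))) stepE
                   , ≋-trans (≡⇒≋ (cong afterN (2*suc n))) stepN
  where
  open PolySolver
  a = even (𝟙 ⊞ X) X n
  b = odd (𝟙 ⊞ X) X n
  ihE = proj₁ (after-even n)
  ihN = proj₂ (after-even n)
  stepE = ≋-trans (⊞-cong (⊞-cong ihE ihN) (⊞-cong (⊠-congˡ X ihE) ihN))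
    (solve 3 (λ x a b → (a :+ x :* b) :+ (x :* a :+ x :* b)
                     := (con 1 :+ x) :* a :+ x :* (b :+ b)) ≋-refl X a b)
  stepN = ≋-trans (⊞-cong (⊠-congˡ X (⊞-cong ihE ihN)) (⊞-cong (⊠-congˡ X ihE) ihN))
    (solve 3 (λ x a b → x :* (a :+ x :* b) :+ (x :* a :+ x :* b)
                     := x :* ((con 1 :+ x) :* b :+ (a :+ a))) ≋-refl X a b)

genFun-words-even : ∀ n → genFun (peaksE ∘ toList) (words (pred (2 * suc n))) ≋ even (𝟙 ⊞ X) X (suc n)
genFun-words-even n = ≋-trans (proj₁ (genFun-peaks (pred (2 * suc n)))) (proj₁ (after-even (suc n)))

coeff-even : ∀ n i → coeff (even (𝟙 ⊞ X) X n) i ≡ + ((2 * n) C (2 * i))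
coeff-even n i = trans (sym (at (proj₁ (after-even n)) i)) (proj₁ (coeff-after (2 * n) i))

-- The coefficients are the binomial coefficients of 2 n over 2 k, so k ↦ n - k is the symmetry of
-- row 2 n, and the top coefficient is 1.
even-symmetric : ∀ n → IsSymmetric (even (𝟙 ⊞ X) X n) n
even-symmetric n =
    ((λ e → 1≢0 (ℤ.+-injective (trans (cong +_ (sym (nCn≡1 (2 * n)))) (trans (sym (coeff-even n n)) e))))
    , λ k n<k → trans (coeff-even n k) (cong +_ (k>n⇒nCk≡0 (*-monoʳ-< 2 n<k))))
  , λ k k≤n → trans (coeff-even n k) (trans
      (cong +_ (trans (nCk≡nC[n∸k] (*-monoʳ-≤ 2 k≤n)) (cong ((2 * n) C_) (sym (*-distribˡ-∸ 2 n k)))))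
      (sym (coeff-even n (n ∸ k))))
  where
  1≢0 : 1 ≢ 0
  1≢0 ()

-- The gamma-polynomial and its closed form

coeff-applyUpTo : ∀ (f : ℕ → ℤ) k → (∀ i → k ≤ i → f i ≡ + 0) → ∀ i → coeff (applyUpTo f k) i ≡ f i
coeff-applyUpTo f zero    f≡0 i       = sym (f≡0 i z≤n)
coeff-applyUpTo f (suc k) f≡0 zero    = refl
coeff-applyUpTo f (suc k) f≡0 (suc i) = coeff-applyUpTo (f ∘ suc) k (λ i → f≡0 (suc i) ∘ s≤s) i

applyUpTo-⟪⟫ : ∀ (f : ℕ → ℤ) q k → applyUpTo f k ⟪ q ⟫ ≋ ∑ (applyUpTo (λ i → f i ∙ q ^ᴾ i) k)
applyUpTo-⟪⟫ f q zero    = ≋-refl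
applyUpTo-⟪⟫ f q (suc k) = ⊞-cong (≡⇒≋ (cong (_∷ []) (sym (ℤ.*-identityʳ (f 0)))))
  (≋-trans (⊠-congˡ q (applyUpTo-⟪⟫ (f ∘ suc) q k))
  (≋-trans (≋-sym (∑-⊠ q _ k)) (∑-cong (λ i → ⊠-∙ (f (suc i)) q (q ^ᴾ i)) k)))

⟪X⟫ : ∀ p → p ⟪ X ⟫ ≋ p
⟪X⟫ []      = ≋-refl
⟪X⟫ (a ∷ p) = ≋-trans (⊞-cong (≋-refl {a ∷ []}) (≋-trans (X-⊠ (p ⟪ X ⟫)) (∷-cong refl (⟪X⟫ p))))
  (∷-cong (ℤ.+-identityʳ a) ≋-refl)

1^ : ∀ k → 𝟙 ^ᴾ k ≋ 𝟙
1^ zero    = ≋-refl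
1^ (suc k) = ≋-trans (⊠-identityˡ _) (1^ k)

gammaCoeff : ℕ → ℕ → ℤ
gammaCoeff n i = + weight n (2 * i)

gamma : ℕ → Poly
gamma n = applyUpTo (gammaCoeff n) (suc ⌊ n /2⌋)

coeff-gamma : ∀ n i → coeff (gamma n) i ≡ gammaCoeff n i
coeff-gamma n = coeff-applyUpTo (gammaCoeff n) (suc ⌊ n /2⌋) λ i h<i →
  cong +_ (weight-vanishes {n} {2 * i} (<-≤-trans (n<2*1+⌊n/2⌋ n) (*-monoʳ-≤ 2 h<i)))

gamma-⟪⟫-sum : ∀ n q → gamma n ⟪ q ⟫ ≋ ∑[0⋯ ⌊ n /2⌋ ] (λ i → gammaCoeff n i ∙ q ^ᴾ i)
gamma-⟪⟫-sum n q = ≋-trans (applyUpTo-⟪⟫ (gammaCoeff n) q (suc ⌊ n /2⌋))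
  (≡⇒≋ (sym (∑[0⋯]-applyUpTo (λ i → gammaCoeff n i ∙ q ^ᴾ i) ⌊ n /2⌋)))

-- For u = 1 the powers of u disappear from the binomial expansion. The substituted q is arbitrary:
-- q = X compares `gamma` with the count of admissible words, q = X² gives the closed form.
gamma-⟪⟫ : ∀ n q → gamma n ⟪ q ⟫ ≋ even 𝟙 q n
gamma-⟪⟫ n q = ≋-trans (gamma-⟪⟫-sum n q)
  (≋-trans (∑[0⋯]-cong ⌊ n /2⌋ summand) (≋-sym (even-expansion 𝟙 q n)))
  where
  summand : ∀ i → gammaCoeff n i ∙ q ^ᴾ i ≋ term 𝟙 (q ^ᴾ i) n (2 * i)
  summand i = ∙-cong (gammaCoeff n i) (≋-sym (≋-trans (⊠-congˡ (q ^ᴾ i) (1^ (n ∸ 2 * i)))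
    (≋-trans (⊠-comm (q ^ᴾ i) 𝟙) (⊠-identityˡ _))))

gamma-even : ∀ n → gamma n ≋ even 𝟙 X n
gamma-even n = ≋-trans (≋-sym (⟪X⟫ (gamma n))) (gamma-⟪⟫ n X)

gamma-sum : ∀ n → gamma n ≋ ∑[0⋯ ⌊ n /2⌋ ] (λ i → gammaCoeff n i ∙ X ^ᴾ i)
gamma-sum n = ≋-trans (≋-sym (⟪X⟫ (gamma n))) (gamma-⟪⟫-sum n X)

-- After the substitution of X² for the variable, X and -X are its square roots within the
-- polynomials. The factor 2 on the left stands for the division by 2.
gamma-closedForm : ∀ n → (+ 2) ∙ gamma n ⟪ X ^ᴾ 2 ⟫ ≋ (𝟙 ⊞ (+ 2) ∙ X) ^ᴾ n ⊞ (𝟙 ⊟ (+ 2) ∙ X) ^ᴾ n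
gamma-closedForm n = begin
  (+ 2) ∙ gamma n ⟪ X ^ᴾ 2 ⟫
    ≈⟨ ∙-cong (+ 2) (gamma-⟪⟫ n (X ^ᴾ 2)) ⟩
  (+ 2) ∙ a
    ≈⟨ double ⟩
  a ⊞ a
    -- Adding (X - X) b = 0 brings in the odd parts of both powers. In the semiring -X is a separate
    -- element whose sum with X vanishes.
    ≈⟨ ≋-sym (≋-trans (⊞-cong ≋-refl (⊠-cong x-x≋0 ≋-refl)) (⊞-identityʳ (a ⊞ a))) ⟩
  (a ⊞ a) ⊞ (X ⊞ -X) ⊠ b
    ≈⟨ solve 4 (λ a b x y → (a :+ a) :+ (x :+ y) :* b := (a :+ x :* b) :+ (a :+ y :* b)) ≋-refl a b X -X ⟩
  (a ⊞ X ⊠ b) ⊞ (a ⊞ -X ⊠ b)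
    ≈⟨ ⊞-cong (power-split 𝟙 (X ^ᴾ 2) X X² n) (power-split 𝟙 (X ^ᴾ 2) -X X²′ n) ⟩
  (𝟙 ⊞ (+ 2) ∙ X) ^ᴾ n ⊞ (𝟙 ⊟ (+ 2) ∙ X) ^ᴾ n ∎
  where
  open ≋-Reasoning
  open PolySolver
  a = even 𝟙 (X ^ᴾ 2) n
  b = odd 𝟙 (X ^ᴾ 2) n
  -X : Poly
  -X = + 0 ∷ ℤ.- (+ 1) ∷ []
  double : (+ 2) ∙ a ≋ a ⊞ a
  double = ≋-trans (∙-distribʳ 1 1 a) (⊞-cong one one)
    where
    one : (+ 1) ∙ a ≋ a
    one .at k = trans (coeff-∙ (+ 1) a k) (ℤ.*-identityˡ _)
  x-x≋0 : X ⊞ -X ≋ []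
  x-x≋0 .at zero          = refl
  x-x≋0 .at (suc zero)    = refl
  x-x≋0 .at (suc (suc k)) = refl
  X² : X ⊠ X ≋ X ^ᴾ 2
  X² .at zero                = refl
  X² .at (suc zero)          = refl
  X² .at (suc (suc zero))    = refl
  X² .at (suc (suc (suc zero)))    = refl
  X² .at (suc (suc (suc (suc k)))) = refl
  X²′ : -X ⊠ -X ≋ X ^ᴾ 2
  X²′ .at zero                = refl
  X²′ .at (suc zero)          = refl
  X²′ .at (suc (suc zero))    = refl
  X²′ .at (suc (suc (suc zero)))    = refl
  X²′ .at (suc (suc (suc (suc k)))) = refl

gamma-isGammaPolynomial : ∀ {p} n → p ≋ even (𝟙 ⊞ X) X n → IsGammaPolynomial p (gamma n)
gamma-isGammaPolynomial {p} n e = record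
  { d = n
  ; symmetric = ((λ z → proj₁ (proj₁ sym-even) (trans (sym (at e n)) z))
                , λ k n<k → trans (at e k) (proj₂ (proj₁ sym-even) k n<k))
              , λ k k≤n → trans (at e k) (trans (proj₂ sym-even k k≤n) (sym (at e (n ∸ k))))
  ; bounded = λ i n<2i → trans (coeff-gamma n i) (cong +_ (weight-vanishes {n} {2 * i} n<2i))
  ; expansion = at (≋-trans e (≋-trans (even-expansion (𝟙 ⊞ X) X n)
      (∑[0⋯]-cong ⌊ n /2⌋ λ i → ≡⇒≋ (cong (_∙ (X ^ᴾ i ⊠ (𝟙 ⊞ X) ^ᴾ (n ∸ 2 * i))) (sym (coeff-gamma n i))))))
  }
  where sym-even = even-symmetric n

-- Abelian Dyck paths

#E-++ : ∀ u v → #E (u ++ v) ≡ #E u + #E v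
#E-++ []      v = refl
#E-++ (N ∷ u) v = #E-++ u v
#E-++ (E ∷ u) v = cong suc (#E-++ u v)

#N-++ : ∀ u v → #N (u ++ v) ≡ #N u + #N v
#N-++ []      v = refl
#N-++ (N ∷ u) v = cong suc (#N-++ u v)
#N-++ (E ∷ u) v = #N-++ u v

#E-replicateE : ∀ k → #E (replicate k E) ≡ k
#E-replicateE zero    = refl
#E-replicateE (suc k) = cong suc (#E-replicateE k)

#E-replicateN : ∀ k → #E (replicate k N) ≡ 0
#E-replicateN zero    = refl
#E-replicateN (suc k) = #E-replicateN k

#N-replicateE : ∀ k → #N (replicate k E) ≡ 0
#N-replicateE zero    = refl
#N-replicateE (suc k) = #N-replicateE k

#N-replicateN : ∀ k → #N (replicate k N) ≡ k
#N-replicateN zero    = refl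
#N-replicateN (suc k) = cong suc (#N-replicateN k)

#E+#N : ∀ w → #E w + #N w ≡ length w
#E+#N []      = refl
#E+#N (N ∷ w) = trans (+-suc (#E w) (#N w)) (cong suc (#E+#N w))
#E+#N (E ∷ w) = cong suc (#E+#N w)

nth : List ℕ → ℕ → ℕ
nth []       i       = 0
nth (x ∷ xs) zero    = x
nth (x ∷ xs) (suc i) = nth xs i

nth-ext : ∀ {xs ys} → length xs ≡ length ys → (∀ i → i < length xs → nth xs i ≡ nth ys i) → xs ≡ ys
nth-ext {[]}     {[]}     _ _ = refl
nth-ext {x ∷ xs} {y ∷ ys} l e =
  cong₂ _∷_ (e 0 z<s) (nth-ext (suc-injective l) (λ i i< → e (suc i) (s<s i<)))

-- The assumption P 0 covers the default value of `nth` past the end.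
nth-All : ∀ {P : ℕ → Set} {xs} → P 0 → All P xs → ∀ i → P (nth xs i)
nth-All p0 []       i       = p0
nth-All p0 (p ∷ ps) zero    = p
nth-All p0 (p ∷ ps) (suc i) = nth-All p0 ps i

nth-replicate-< : ∀ {k i} ys → i < k → nth (replicate k 0 ++ ys) i ≡ 0
nth-replicate-< {suc k} {zero}  ys _         = refl
nth-replicate-< {suc k} {suc i} ys (s<s i<k) = nth-replicate-< ys i<k

nth-replicate-≡ : ∀ k ys → nth (replicate k 0 ++ ys) k ≡ nth ys 0
nth-replicate-≡ zero    ys = refl
nth-replicate-≡ (suc k) ys = nth-replicate-≡ k ys

-- The abscissas of the N steps of a path starting on the line of abscissa x.
columns : ℕ → Path → List ℕ
columns x []      = []
columns x (N ∷ w) = x ∷ columns x w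
columns x (E ∷ w) = columns (suc x) w

length-columns : ∀ x w → length (columns x w) ≡ #N w
length-columns x []      = refl
length-columns x (N ∷ w) = cong suc (length-columns x w)
length-columns x (E ∷ w) = length-columns (suc x) w

columns-≥ : ∀ x w → All (x ≤_) (columns x w)
columns-≥ x []      = []
columns-≥ x (N ∷ w) = ≤-refl ∷ columns-≥ x w
columns-≥ x (E ∷ w) = All.map (≤-trans (n≤1+n x)) (columns-≥ (suc x) w)

columns-≤ : ∀ x w → All (_≤ x + #E w) (columns x w)
columns-≤ x []      = []
columns-≤ x (N ∷ w) = m≤m+n x (#E w) ∷ columns-≤ x w
columns-≤ x (E ∷ w) = subst (λ y → All (_≤ y) (columns (suc x) w)) (sym (+-suc x (#E w))) (columns-≤ (suc x) w)

columns-mono : ∀ x w i → suc i < #N w → nth (columns x w) i ≤ nth (columns x w) (suc i)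
columns-mono x (N ∷ w) (suc i) (s<s i<) = columns-mono x w i i<
columns-mono x (E ∷ w) i       i<       = columns-mono (suc x) w i i<
columns-mono x (N ∷ w) zero    (s<s 0<) with columns x w | columns-≥ x w | length-columns x w
... | []    | _       | l = contradiction (subst (0 <_) (sym l) 0<) λ ()
... | y ∷ _ | x≤y ∷ _ | _ = x≤y

columns-++-E : ∀ x w j → columns x (w ++ replicate j E) ≡ columns x w
columns-++-E x []      zero    = refl
columns-++-E x []      (suc j) = columns-++-E (suc x) [] j
columns-++-E x (N ∷ w) j       = cong (x ∷_) (columns-++-E x w j)
columns-++-E x (E ∷ w) j       = columns-++-E (suc x) w j

columns-N-++ : ∀ x k w → columns x (replicate k N ++ w) ≡ replicate k x ++ columns x w
columns-N-++ x zero    w = refl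
columns-N-++ x (suc k) w = cong (x ∷_) (columns-N-++ x k w)

nth-columns : ∀ x u v → nth (columns x (u ++ N ∷ v)) (#N u) ≡ x + #E u
nth-columns x []      v = sym (+-identityʳ x)
nth-columns x (N ∷ u) v = nth-columns x u v
nth-columns x (E ∷ u) v = trans (nth-columns (suc x) u v) (sym (+-suc x (#E u)))

split-at-N : ∀ w {i} → i < #N w → ∃[ u ] ∃[ v ] w ≡ u ++ N ∷ v × #N u ≡ i
split-at-N (N ∷ w) {zero}  _        = [] , w , refl , refl
split-at-N (N ∷ w) {suc i} (s<s i<) =
  let u , v , e , l = split-at-N w i< in N ∷ u , v , cong (N ∷_) e , cong suc l
split-at-N (E ∷ w) i< = let u , v , e , l = split-at-N w i< in E ∷ u , v , cong (E ∷_) e , l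

-- The columns locate every N step, but E steps after the last N leave no trace in them; the
-- equality of the numbers of E steps accounts for these.
columns-injective : ∀ x w w′ → columns x w ≡ columns x w′ → #E w ≡ #E w′ → w ≡ w′
columns-injective x []      []       _ _ = refl
columns-injective x []      (E ∷ w′) _ ()
columns-injective x (E ∷ w) []       _ ()
columns-injective x (N ∷ w) (N ∷ w′) c e = cong (N ∷_) (columns-injective x w w′ (∷-injectiveʳ c) e)
columns-injective x (E ∷ w) (E ∷ w′) c e = cong (E ∷_) (columns-injective (suc x) w w′ c (suc-injective e))
columns-injective x (N ∷ w) (E ∷ w′) c e with columns (suc x) w′ | columns-≥ (suc x) w′
columns-injective x (N ∷ w) (E ∷ w′) refl e | _ | x<x ∷ _ = contradiction x<x (n≮n x)
columns-injective x (E ∷ w) (N ∷ w′) c e with columns (suc x) w | columns-≥ (suc x) w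
columns-injective x (E ∷ w) (N ∷ w′) refl e | _ | x<x ∷ _ = contradiction x<x (n≮n x)

-- For a weakly increasing list this is the number of distinct entries: each value is counted at its
-- last occurrence, hence the 1 for a final entry.
ascents : List ℕ → ℕ
ascents []           = 0
ascents (x ∷ [])     = 1
ascents (x ∷ y ∷ ys) = (if x <ᵇ y then 1 else 0) + ascents (y ∷ ys)

ascents-< : ∀ {x y} ys → x < y → ascents (x ∷ y ∷ ys) ≡ suc (ascents (y ∷ ys))
ascents-< {x} {y} ys x<y rewrite dec-true (x <? y) x<y = refl

ascents-≮ : ∀ {x y} ys → x ≮ y → ascents (x ∷ y ∷ ys) ≡ ascents (y ∷ ys)
ascents-≮ {x} {y} ys x≮y rewrite dec-false (x <? y) x≮y = refl

-- The last N step in each occupied column is followed by E; the appended E provides this for the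
-- last column too.
ascents-columns : ∀ x w → ascents (columns x w) ≡ peaksE w
ascents-columns x []          = refl
ascents-columns x (E ∷ w)     = ascents-columns (suc x) w
ascents-columns x (N ∷ [])    = refl
ascents-columns x (N ∷ N ∷ w) = trans (ascents-≮ (columns x w) (n≮n x)) (ascents-columns x (N ∷ w))
ascents-columns x (N ∷ E ∷ w) with columns (suc x) w | columns-≥ (suc x) w | ascents-columns (suc x) w
... | []     | _       | e = cong suc e
... | y ∷ ys | x<y ∷ _ | e = trans (ascents-< ys x<y) (cong suc e)

-- The Abelian Dyck path (k , E w), of semilength 1 + length w.
dyck : Path → Path
dyck w = replicate (suc (#E w)) N ++ (E ∷ w) ++ replicate (#N w) E

columns-dyck : ∀ w → columns 0 (dyck w) ≡ replicate (suc (#E w)) 0 ++ columns 1 w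
columns-dyck w = trans (columns-N-++ 0 (suc (#E w)) _)
  (cong (replicate (suc (#E w)) 0 ++_) (columns-++-E 1 w (#N w)))

-- The columns ignore the trailing E steps, so those are dropped first. The initial run of N steps
-- then accounts for the extra column 0.
ascents-dyck : ∀ w → ascents (columns 0 (dyck w)) ≡ suc (peaksE w)
ascents-dyck w = trans (cong ascents (trans (columns-dyck w) (sym (columns-N-++ 0 (suc (#E w)) (E ∷ w)))))
  (trans (ascents-columns 0 (replicate (suc (#E w)) N ++ E ∷ w)) (plateau (#E w)))
  where
  plateau : ∀ k → peaksE (replicate (suc k) N ++ E ∷ w) ≡ suc (peaksE w)
  plateau zero    = refl
  plateau (suc k) = plateau k

-- The number of trailing E steps matters only through a possible final N of w, and then #N w ≤ j
-- makes j positive.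
peaks-++-E : ∀ w {j} → #N w ≤ j → peaks (w ++ replicate j E) ≡ peaksE w
peaks-++-E []          {zero}  _ = refl
peaks-++-E []          {suc j} _ = peaks-++-E [] {j} z≤n
peaks-++-E (E ∷ w)     l = peaks-++-E w l
peaks-++-E (N ∷ [])    {suc j} _ = cong suc (peaks-++-E [] {j} z≤n)
peaks-++-E (N ∷ N ∷ w) l = peaks-++-E (N ∷ w) (<⇒≤ l)
peaks-++-E (N ∷ E ∷ w) l = cong suc (peaks-++-E w (<⇒≤ l))

peaks-dyck : ∀ w → peaks (dyck w) ≡ suc (peaksE w)
peaks-dyck w = trans (plateau (#E w)) (cong suc (peaks-++-E w ≤-refl))
  where
  plateau : ∀ k → peaks (replicate (suc k) N ++ E ∷ w ++ replicate (#N w) E)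
                  ≡ suc (peaks (w ++ replicate (#N w) E))
  plateau zero    = refl
  plateau (suc k) = plateau k

#E-dyck : ∀ w → #E (dyck w) ≡ suc (length w)
#E-dyck w rewrite #E-++ (replicate (#E w) N) (E ∷ w ++ replicate (#N w) E)
  | #E-replicateN (#E w) | #E-++ w (replicate (#N w) E) | #E-replicateE (#N w) = cong suc (#E+#N w)

#N-dyck : ∀ w → #N (dyck w) ≡ suc (length w)
#N-dyck w rewrite #N-++ (replicate (#E w) N) (E ∷ w ++ replicate (#N w) E)
  | #N-replicateN (#E w) | #N-++ w (replicate (#N w) E) | #N-replicateE (#N w)
  | +-identityʳ (#N w) = cong suc (#E+#N w)

-- The Dyck condition for a path that starts h units above the diagonal, so that it can be proved
-- step by step.
Above : ℕ → Path → Set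
Above h w = ∀ u v → w ≡ u ++ v → #E u ≤ h + #N u

above-[] : ∀ h → Above h []
above-[] h [] v e = z≤n

above-N : ∀ {h w} → Above (suc h) w → Above h (N ∷ w)
above-N     p []      v e    = z≤n
above-N {h} p (N ∷ u) v refl = subst (#E u ≤_) (sym (+-suc h (#N u))) (p u v refl)

above-E : ∀ {h w} → Above h w → Above (suc h) (E ∷ w)
above-E p []      v e    = z≤n
above-E p (E ∷ u) v refl = s≤s (p u v refl)

-- With at most h steps E, the word w cannot pass below the diagonal wherever its N steps are. The
-- final run of E steps only descends, so checking its endpoint is enough.
above-few-E : ∀ h w j → #E w ≤ h → #E w + j ≤ h + #N w → Above h (w ++ replicate j E)
above-few-E h       []      zero    _ _ = above-[] h
above-few-E (suc h) []      (suc j) _ (s≤s l) = above-E (above-few-E h [] j z≤n l)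
above-few-E h       (N ∷ w) j       e l =
  above-N (above-few-E (suc h) w j (m≤n⇒m≤1+n e) (subst (#E w + j ≤_) (+-suc h (#N w)) l))
above-few-E (suc h) (E ∷ w) j (s≤s e) (s≤s l) = above-E (above-few-E h w j e l)

above-N^ : ∀ {h w} k → Above (h + k) w → Above h (replicate k N ++ w)
above-N^ {h} {w} zero    p = subst (λ h → Above h w) (+-identityʳ h) p
above-N^ {h} {w} (suc k) p = above-N (above-N^ k (subst (λ h → Above h w) (+-suc h k) p))

dyck-isDyckPath : ∀ w → IsDyckPath (suc (length w)) (dyck w)
dyck-isDyckPath w = record
  { endpoint = #E-dyck w , #N-dyck w
  ; above    = above-N^ (suc (#E w)) (above-few-E _ (E ∷ w) (#N w) ≤-refl ≤-refl)
  }

-- The initial run of N steps reveals #E w, and the total number of N steps then reveals #N w, so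
-- the trailing runs agree and cancel.
dyck-injective : ∀ {w w′} → dyck w ≡ dyck w′ → w ≡ w′
dyck-injective {w} {w′} e = ++-cancelʳ (replicate (#N w) E) w w′
  (trans (∷-injectiveʳ e″) (cong (λ j → w′ ++ replicate j E) (sym #N≡)))
  where
  N^E-injective : ∀ k k′ {v v′} → replicate k N ++ E ∷ v ≡ replicate k′ N ++ E ∷ v′ →
                  k ≡ k′ × _≡_ {A = Path} (E ∷ v) (E ∷ v′)
  N^E-injective zero    zero     e = refl , e
  N^E-injective (suc k) (suc k′) e =
    let k≡ , v≡ = N^E-injective k k′ (∷-injectiveʳ e) in cong suc k≡ , v≡
  split = N^E-injective (suc (#E w)) (suc (#E w′)) e
  e″ = proj₂ split
  #E≡ : #E w ≡ #E w′
  #E≡ = suc-injective (proj₁ split)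
  #N≡ : #N w ≡ #N w′
  #N≡ = +-cancelˡ-≡ (#E w) (#N w) (#N w′) (trans (#E+#N w) (trans
    (suc-injective (trans (sym (#N-dyck w)) (trans (cong #N e) (#N-dyck w′))))
    (trans (sym (#E+#N w′)) (cong (_+ #N w′) (sym #E≡)))))

-- Peak-edges

unique∧set⇒↭ : ∀ {A : Set} {xs ys : List A} → Unique xs → Unique ys →
               (∀ x → x ∈ xs ⇔ x ∈ ys) → xs ↭ ys
unique∧set⇒↭ u v e = ∼bag⇒↭ (unique∧set⇒bag u v λ {x} → e x)

length-filter-split : ∀ {A : Set} {P Q R : A → Set}
  (P? : Decidable P) (Q? : Decidable Q) (R? : Decidable R) →
  (∀ x → R x → P x ⊎ Q x) → (∀ {x} → P x → R x) → (∀ {x} → Q x → R x) → (∀ {x} → P x → ¬ Q x) →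
  ∀ xs → length (filter P? xs) + length (filter Q? xs) ≡ length (filter R? xs)
length-filter-split P? Q? R? r p q d [] = refl
length-filter-split P? Q? R? r p q d (x ∷ xs) with R? x
... | no ¬R rewrite filter-reject P? {x} {xs} (¬R ∘ p) | filter-reject Q? {x} {xs} (¬R ∘ q)
  = length-filter-split P? Q? R? r p q d xs
... | yes R with r x R
...   | inj₁ P rewrite filter-accept P? {x} {xs} P | filter-reject Q? {x} {xs} (d P)
  = cong suc (length-filter-split P? Q? R? r p q d xs)
...   | inj₂ Q rewrite filter-reject P? {x} {xs} (λ P → d P Q) | filter-accept Q? {x} {xs} Q
  = trans (+-suc _ _) (cong suc (length-filter-split P? Q? R? r p q d xs))

-- For weakly increasing `b`, j is the last position with its value. The final position qualifies
-- vacuously.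
IsLast : ∀ {m} → (Fin m → ℕ) → Fin m → Set
IsLast b j = ∀ j⁺ → toℕ j⁺ ≡ suc (toℕ j) → b j < b j⁺

isLast? : ∀ {m} (b : Fin m → ℕ) → Decidable (IsLast b)
isLast? b j = all? λ j⁺ → (toℕ j⁺ ≟ suc (toℕ j)) →-dec (b j <? b j⁺)

length-filter-tabulate : ∀ {A B : Set} {P : A → Set} {Q : B → Set} (P? : Decidable P) (Q? : Decidable Q)
  n (f : Fin n → A) (g : Fin n → B) → (∀ i → P (f i) ⇔ Q (g i)) →
  length (filter P? (tabulate f)) ≡ length (filter Q? (tabulate g))
length-filter-tabulate P? Q? zero    f g e = refl
length-filter-tabulate P? Q? (suc n) f g e with P? (f zero) | Q? (g zero)
... | yes p | yes q = cong suc (length-filter-tabulate P? Q? n (f ∘ suc) (g ∘ suc) (e ∘ suc))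
... | no ¬p | no ¬q = length-filter-tabulate P? Q? n (f ∘ suc) (g ∘ suc) (e ∘ suc)
... | yes p | no ¬q = contradiction (Equivalence.to (e zero) p) ¬q
... | no ¬p | yes q = contradiction (Equivalence.from (e zero) q) ¬p

count-isLast : ∀ {m} (b : Fin m → ℕ) → length (filter (isLast? b) (allFin m)) ≡ ascents (tabulate b)
count-isLast {zero}        b = refl
count-isLast {suc zero}    b = cong length (filter-accept (isLast? b) {zero} {[]} λ { zero () })
count-isLast {suc (suc m)} b = trans first (cong (λ l → bump (b zero <ᵇ b (suc zero)) + l)
    (trans (length-filter-tabulate (isLast? b) (isLast? (b ∘ suc)) (suc m) suc (λ i → i) shift)
           (count-isLast (b ∘ suc))))
  where
  bump : Bool → ℕ
  bump c = if c then 1 else 0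
  shift : ∀ i → IsLast b (suc i) ⇔ IsLast (b ∘ suc) i
  shift i = mk⇔ (λ l j⁺ e → l (suc j⁺) (cong suc e))
                (λ { l (suc j⁺) e → l j⁺ (suc-injective e) })
  rest : List (Fin (suc (suc m)))
  rest = tabulate suc
  first : length (filter (isLast? b) (zero ∷ rest))
          ≡ bump (b zero <ᵇ b (suc zero)) + length (filter (isLast? b) rest)
  first = case b zero <? b (suc zero) of λ where
    (yes l) → trans
      (cong length (filter-accept (isLast? b) {zero} {rest} λ { (suc zero) _ → l }))
      (cong (λ c → bump c + length (filter (isLast? b) rest)) (sym (dec-true (b zero <? b (suc zero)) l)))
    (no ≮) → trans
      (cong length (filter-reject (isLast? b) {zero} {rest} λ l → ≮ (l (suc zero) refl)))
      (cong (λ c → bump c + length (filter (isLast? b) rest)) (sym (dec-false (b zero <? b (suc zero)) ≮)))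

-- The abscissa i - 1 - a_i of the i-th N step.
col : ∀ {m} → Vec ℕ m → Fin m → ℕ
col a i = toℕ i ∸ lookup a i

col≤ : ∀ {m} (a : Vec ℕ m) i → col a i ≤ toℕ i
col≤ a i = m∸n≤m (toℕ i) (lookup a i)

module _ {m : ℕ} (a : Vec ℕ m) (isArea : IsAreaSequence a) where

  open Graph a using (Edge; Adjacent; Isolated; PeakPair; isolated?; peakPair?)

  label∸ : ∀ i → label i ∸ lookup a i ≡ suc (col a i)
  label∸ i = +-∸-assoc 1 (≤-pred (proj₁ isArea i))

  -- Counted from 0, the smaller neighbours of i are exactly the positions from `col a i` to i - 1.
  -- All arguments about the graph use edges in this form.
  edge⁺ : ∀ {j i} → toℕ j < toℕ i → col a i ≤ toℕ j → Edge j i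
  edge⁺ {j} {i} j<i c = s<s j<i , subst (_≤ label j) (sym (label∸ i)) (s≤s c)

  edge⁻ : ∀ {j i} → Edge j i → toℕ j < toℕ i × col a i ≤ toℕ j
  edge⁻ {j} {i} (j<i , c) = ≤-pred j<i , ≤-pred (subst (_≤ label j) (label∸ i) c)

  col-step : ∀ {i i′} → toℕ i′ ≡ suc (toℕ i) → col a i ≤ col a i′
  col-step {i} {i′} e = begin
    toℕ i ∸ lookup a i             ≤⟨ ∸-monoʳ-≤ (suc (toℕ i)) (proj₂ isArea i′ i (cong suc e)) ⟩
    suc (toℕ i) ∸ lookup a i′      ≡⟨ cong (_∸ lookup a i′) e ⟨
    col a i′                       ∎
    where open ≤-Reasoning

  col-mono : ∀ {i i′} → toℕ i ≤ toℕ i′ → col a i ≤ col a i′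
  col-mono {i} {i′} i≤i′ = go (toℕ i′) i′ refl i≤i′
    where
    go : ∀ n i′ → toℕ i′ ≡ n → toℕ i ≤ n → col a i ≤ col a i′
    go n i′ e i≤n with toℕ i ≟ n
    ... | yes i≡n = ≤-reflexive (cong (col a) (toℕ-injective (trans i≡n (sym e))))
    go zero    i′ e i≤n | no i≢n = contradiction (n≤0⇒n≡0 i≤n) i≢n
    go (suc n) i′ e i≤n | no i≢n =
      ≤-trans (go n j j≡n (≤-pred (≤∧≢⇒< i≤n i≢n))) (col-step (trans e (cong suc (sym j≡n))))
      where
      n<m : n < m
      n<m = <-trans (n<1+n n) (subst (_< m) e (toℕ<n i′))
      j = fromℕ< n<m
      j≡n = toℕ-fromℕ< n<m

  -- A column equal to v excludes smaller neighbours. As columns increase weakly, a larger neighbour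
  -- would force the next vertex to be a neighbour, against `IsLast`.
  isolated⁺ : ∀ {v} → col a v ≡ toℕ v → IsLast (col a) v → Isolated v
  isolated⁺ {v} c l u (inj₁ e) = n≮n (toℕ v)
    (≤-<-trans (subst (_≤ toℕ u) c (proj₂ (edge⁻ e))) (proj₁ (edge⁻ e)))
  isolated⁺ {v} c l u (inj₂ e) = n≮n (col a v) (begin-strict
    col a v   <⟨ l v⁺ (toℕ-fromℕ< _) ⟩
    col a v⁺  ≤⟨ col-mono (subst (_≤ toℕ u) (sym (toℕ-fromℕ< _)) v<u) ⟩
    col a u   ≤⟨ proj₂ (edge⁻ e) ⟩
    toℕ v     ≡⟨ c ⟨
    col a v   ∎)
    where
    open ≤-Reasoning
    v<u = proj₁ (edge⁻ e)
    v⁺ = fromℕ< (≤-<-trans v<u (toℕ<n u))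

  isolated⁻ : ∀ {v} → Isolated v → col a v ≡ toℕ v × IsLast (col a) v
  isolated⁻ {v} iso = c , last
    where
    c : col a v ≡ toℕ v
    c with m≤n⇒m<n∨m≡n (col≤ a v)
    ... | inj₂ e = e
    -- A column strictly below v is itself the position of a smaller neighbour of v.
    ... | inj₁ l = contradiction (inj₁ (edge⁺ (subst (_< toℕ v) (sym (toℕ-fromℕ< _)) l) (≤-reflexive (sym (toℕ-fromℕ< _)))))
                                 (iso (fromℕ< (<-trans l (toℕ<n v))))
    last : IsLast (col a) v
    last v⁺ e = subst (_< col a v⁺) (sym c) (≰⇒> λ cv⁺≤v →
      iso v⁺ (inj₂ (edge⁺ (≤-reflexive (sym e)) cv⁺≤v)))

  -- The edge cannot be extended to i - 1 because i is the smallest neighbour of j, namely its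
  -- column; it cannot be extended to j + 1 because the next column lies beyond i.
  peakPair⁺ : ∀ {i j} → toℕ i ≡ col a j → col a j < toℕ j → IsLast (col a) j → PeakPair (i , j)
  peakPair⁺ {i} {j} i≡ c< l =
      edge⁺ (subst (_< toℕ j) (sym i≡) c<) (≤-reflexive (sym i≡))
    , (λ j⁺ e ed → n≮n (col a j) (<-≤-trans (l j⁺ (suc-injective e)) (subst (col a j⁺ ≤_) i≡ (proj₂ (edge⁻ ed)))))
    , λ i⁻ e ed → n≮n (toℕ i⁻) (subst (_≤ toℕ i⁻) (trans (sym i≡) (suc-injective e)) (proj₂ (edge⁻ ed)))

  peakPair⁻ : ∀ {i j} → PeakPair (i , j) → toℕ i ≡ col a j × col a j < toℕ j × IsLast (col a) j
  peakPair⁻ {i} {j} (ed , right , left) = i≡ , ≤-<-trans c≤i i<j , last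
    where
    i<j = proj₁ (edge⁻ ed)
    c≤i = proj₂ (edge⁻ ed)
    i≡ : toℕ i ≡ col a j
    i≡ with m≤n⇒m<n∨m≡n c≤i
    ... | inj₂ e = sym e
    ... | inj₁ c<i = contradiction
      (edge⁺ (subst (_< toℕ j) (sym i⁻≡) (<-trans p<i i<j))
             (subst (col a j ≤_) (sym i⁻≡) (≤-pred (subst (col a j <_) i≡1+ c<i))))
      (left i⁻ (cong suc (trans i≡1+ (cong suc (sym i⁻≡)))))
      where
      i≡1+ : toℕ i ≡ suc (pred (toℕ i))
      i≡1+ = sym (suc-pred (toℕ i) {{>-nonZero (≤-<-trans z≤n c<i)}})
      p<i : pred (toℕ i) < toℕ i
      p<i = ≤-reflexive (sym i≡1+)
      pi<m : pred (toℕ i) < m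
      pi<m = <-trans p<i (toℕ<n i)
      i⁻ = fromℕ< pi<m
      i⁻≡ = toℕ-fromℕ< pi<m
    last : IsLast (col a) j
    last j⁺ e = ≰⇒> λ c⁺≤ → right j⁺ (cong suc e)
      (edge⁺ (<-trans i<j (≤-reflexive (sym e))) (subst (col a j⁺ ≤_) (sym i≡) c⁺≤))

  -- Each last vertex j of a column yields exactly one peak-edge: the isolated vertex j if its
  -- column is j itself, and otherwise the edge from its column to j.
  peak≡ascents : peak a ≡ ascents (tabulate (col a))
  peak≡ascents = trans (cong (λ l → length (filter isolated? (allFin m)) + l) pairs)
    (trans (length-filter-split isolated? nonIsolated? (isLast? (col a)) cases
              (proj₂ ∘ isolated⁻) proj₂ (λ iso q → <⇒≢ (proj₁ q) (proj₁ (isolated⁻ iso))) (allFin m))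
           (count-isLast (col a)))
    where
    NonIsolated : Fin m → Set
    NonIsolated j = col a j < toℕ j × IsLast (col a) j
    nonIsolated? : Decidable NonIsolated
    nonIsolated? j = (col a j <? toℕ j) ×-dec isLast? (col a) j
    cases : ∀ j → IsLast (col a) j → Isolated j ⊎ NonIsolated j
    cases j l with m≤n⇒m<n∨m≡n (col≤ a j)
    ... | inj₁ c< = inj₂ (c< , l)
    ... | inj₂ c≡ = inj₁ (isolated⁺ c≡ l)
    top : Fin m → Fin m
    top j = fromℕ< (≤-<-trans (col≤ a j) (toℕ<n j))
    toℕ-top : ∀ j → toℕ (top j) ≡ col a j
    toℕ-top j = toℕ-fromℕ< _
    pair : Fin m → Fin m × Fin m
    pair j = top j , j
    all = cartesianProduct (allFin m) (allFin m)
    same : ∀ e → e ∈ filter peakPair? all ⇔ e ∈ map pair (filter nonIsolated? (allFin m))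
    same (i , j) = mk⇔
      (λ e∈ → let i≡ , c< , l = peakPair⁻ (proj₂ (∈-filter⁻ peakPair? {xs = all} e∈)) in
         subst (λ i → (i , j) ∈ map pair (filter nonIsolated? (allFin m)))
               (toℕ-injective (trans (toℕ-top j) (sym i≡)))
               (∈-map⁺ pair (∈-filter⁺ nonIsolated? (∈-allFin j) (c< , l))))
      (λ e∈ → back (∈-map⁻ pair e∈))
      where
      back : ∃[ j′ ] j′ ∈ filter nonIsolated? (allFin m) × (i , j) ≡ pair j′ → (i , j) ∈ filter peakPair? all
      back (j′ , j′∈ , refl) with ∈-filter⁻ nonIsolated? {xs = allFin m} j′∈
      ... | _ , c< , l = ∈-filter⁺ peakPair? (∈-cartesianProduct⁺ (∈-allFin _) (∈-allFin _))
                                   (peakPair⁺ (toℕ-top j′) c< l)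
    pairs : length (filter peakPair? all) ≡ length (filter nonIsolated? (allFin m))
    pairs = trans (↭-length (unique∧set⇒↭
      (Unique.filter⁺ peakPair? (Unique.cartesianProduct⁺ (Unique.allFin⁺ m) (Unique.allFin⁺ m)))
      (Unique.map⁺ ,-injectiveʳ (Unique.filter⁺ nonIsolated? (Unique.allFin⁺ m))) same))
      (length-map pair (filter nonIsolated? (allFin m)))

-- Area sequences of Abelian Dyck paths

area : ∀ m → Path → Vec ℕ m
area m w = Vec.tabulate λ i → toℕ i ∸ nth (columns 0 w) (toℕ i)

nth-tabulate : ∀ {m} (f : Fin m → ℕ) i → nth (tabulate f) (toℕ i) ≡ f i
nth-tabulate f zero    = refl
nth-tabulate f (suc i) = nth-tabulate (f ∘ suc) i

module _ {m : ℕ} {w : Path} (dyckPath : IsDyckPath m w) where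

  open IsDyckPath dyckPath

  nth-columns≤ : ∀ {i} → i < m → nth (columns 0 w) i ≤ i
  nth-columns≤ i<m with split-at-N w (subst (_ <_) (sym (proj₂ endpoint)) i<m)
  ... | u , v , refl , refl = subst (_≤ #N u) (sym (nth-columns 0 u v)) (above u (N ∷ v) refl)

  lookup-area : ∀ (i : Fin m) → lookup (area m w) i ≡ toℕ i ∸ nth (columns 0 w) (toℕ i)
  lookup-area i = lookup∘tabulate _ i

  col-area : ∀ i → col (area m w) i ≡ nth (columns 0 w) (toℕ i)
  col-area i = trans (cong (toℕ i ∸_) (lookup-area i)) (m∸[m∸n]≡n (nth-columns≤ (toℕ<n i)))

  area-isAreaSequence : IsAreaSequence (area m w)
  area-isAreaSequence =
      (λ i → s≤s (subst (_≤ toℕ i) (sym (lookup-area i)) (m∸n≤m (toℕ i) (nth (columns 0 w) (toℕ i)))))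
    , λ i i′ e → subst₂ (λ x y → x ≤ suc y) (sym (lookup-area i)) (sym (lookup-area i′)) (step (suc-injective e))
    where
    step : ∀ {i i′ : Fin m} → toℕ i ≡ suc (toℕ i′) →
           toℕ i ∸ nth (columns 0 w) (toℕ i) ≤ suc (toℕ i′ ∸ nth (columns 0 w) (toℕ i′))
    step {i} {i′} e = begin
      toℕ i ∸ nth (columns 0 w) (toℕ i)
        ≡⟨ cong (λ j → j ∸ nth (columns 0 w) j) e ⟩
      suc (toℕ i′) ∸ nth (columns 0 w) (suc (toℕ i′))
        ≤⟨ ∸-monoʳ-≤ (suc (toℕ i′)) (columns-mono 0 w (toℕ i′)
             (subst₂ _<_ e (sym (proj₂ endpoint)) (toℕ<n i))) ⟩
      suc (toℕ i′) ∸ nth (columns 0 w) (toℕ i′)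
        ≡⟨ +-∸-assoc 1 (nth-columns≤ (toℕ<n i′)) ⟩
      suc (toℕ i′ ∸ nth (columns 0 w) (toℕ i′)) ∎
      where open ≤-Reasoning

  area-isAreaSequenceOf : IsAreaSequenceOf (area m w) w
  area-isAreaSequenceOf i u v refl e = begin
    #E u + lookup (area m w) i
      ≡⟨ cong (λ l → #E u + l) (lookup-area i) ⟩
    #E u + (toℕ i ∸ nth (columns 0 w) (toℕ i))
      ≡⟨ cong (λ j → #E u + (j ∸ nth (columns 0 w) j)) (suc-injective e) ⟨
    #E u + (#N u ∸ nth (columns 0 w) (#N u))
      ≡⟨ cong (λ x → #E u + (#N u ∸ x)) (nth-columns 0 u v) ⟩
    #E u + (#N u ∸ #E u)
      ≡⟨ m+[n∸m]≡n (above u (N ∷ v) refl) ⟩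
    #N u ∎
    where open ≡-Reasoning

  tabulate-col-area : tabulate (col (area m w)) ≡ columns 0 w
  tabulate-col-area = nth-ext
    (trans l (sym (trans (length-columns 0 w) (proj₂ endpoint))))
    λ i i< → let i<m = subst (i <_) l i< in
      subst (λ i → nth (tabulate (col (area m w))) i ≡ nth (columns 0 w) i) (toℕ-fromℕ< i<m)
        (trans (nth-tabulate (col (area m w)) (fromℕ< i<m)) (col-area (fromℕ< i<m)))
    where l = length-tabulate (col (area m w))

-- The vertices of column 0 are adjacent to the first vertex. From position k on, a vertex is
-- adjacent to the last one, whose column is at most k.
abelian⁺ : ∀ {r} (a : Vec ℕ (suc r)) → IsAreaSequence a → ∀ k →
           (∀ i → toℕ i < k → col a i ≡ 0) → (∀ i → col a i ≤ k) → IsAbelian a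
abelian⁺ {r} a isArea k early bound v v≢1 v≢m with toℕ v <? k
... | yes v<k = zero , inj₁ refl , inj₁ (edge⁺ a isArea (n≢0⇒n>0 (v≢1 ∘ cong suc)) (≤-reflexive (early v v<k)))
... | no  v≮k = fromℕ r , inj₂ (cong suc (toℕ-fromℕ r))
  , inj₂ (edge⁺ a isArea (subst (toℕ v <_) (sym (toℕ-fromℕ r)) (≤∧≢⇒< (toℕ≤pred[n] v) (v≢m ∘ cong suc)))
                (≤-trans (bound (fromℕ r)) (≮⇒≥ v≮k)))

-- For the first vertex v of positive column, toℕ v is the number k of columns 0:
-- in an Abelian area sequence no column exceeds k.
abelian⁻ : ∀ {r} (a : Vec ℕ (suc r)) → IsAreaSequence a → IsAbelian a →
           ∀ v → 0 < col a v → ∀ i → col a i ≤ toℕ v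
abelian⁻ {r} a isArea abelian v 0<c i with toℕ v ≟ r
... | yes v≡r = ≤-trans (col≤ a i) (subst (toℕ i ≤_) (sym v≡r) (toℕ≤pred[n] i))
... | no  v≢r with abelian v (λ e → <⇒≱ 0<c (subst (col a v ≤_) (suc-injective e) (col≤ a v))) (v≢r ∘ suc-injective)
...   | u , inj₁ u≡1 , inj₁ e = contradiction (subst (col a v ≤_) (suc-injective u≡1) (proj₂ (edge⁻ a isArea e))) (<⇒≱ 0<c)
...   | u , inj₁ u≡1 , inj₂ e = contradiction (subst (toℕ v <_) (suc-injective u≡1) (proj₁ (edge⁻ a isArea e))) λ ()
...   | u , inj₂ u≡m , inj₁ e = contradiction (subst (_< toℕ v) (suc-injective u≡m) (proj₁ (edge⁻ a isArea e))) 
    (≤⇒≯ (toℕ≤pred[n] v))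
...   | u , inj₂ u≡m , inj₂ e = ≤-trans
  (col-mono a isArea (subst (toℕ i ≤_) (sym (suc-injective u≡m)) (toℕ≤pred[n] i))) (proj₂ (edge⁻ a isArea e))

area-abelian : ∀ w → IsAbelian (area (suc (length w)) (dyck w))
area-abelian w = abelian⁺ (area (suc (length w)) (dyck w)) (area-isAreaSequence d) (suc (#E w))
  (λ i i<k → trans (col-area d i) (trans (cong (λ xs → nth xs (toℕ i)) (columns-dyck w)) (nth-replicate-< _ i<k)))
  (λ i → subst (_≤ suc (#E w)) (sym (trans (col-area d i) (cong (λ xs → nth xs (toℕ i)) (columns-dyck w))))
    (nth-All z≤n (All.++⁺ (All.replicate⁺ (suc (#E w)) z≤n) (columns-≤ 1 w)) (toℕ i)))
  where d = dyck-isDyckPath w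

dyck-isAbelianDyckPath : ∀ w → IsAbelianDyckPath (suc (length w)) (dyck w)
dyck-isAbelianDyckPath w = record
  { dyck         = d
  ; a            = area _ (dyck w)
  ; areaSequence = area-isAreaSequence d
  ; ofPath       = area-isAreaSequenceOf d
  ; abelian      = area-abelian w
  }
  where d = dyck-isDyckPath w

peak-area : ∀ w → peak (area (suc (length w)) (dyck w)) ≡ suc (peaksE w)
peak-area w = trans (peak≡ascents (area (suc (length w)) (dyck w)) (area-isAreaSequence d))
  (trans (cong ascents (tabulate-col-area d)) (ascents-dyck w))
  where d = dyck-isDyckPath w

area-injective : ∀ {w w′} → length w ≡ length w′ →
  area (suc (length w)) (dyck w) ≡ area (suc (length w)) (dyck w′) → w ≡ w′
area-injective {w} {w′} l e = dyck-injective (columns-injective 0 (dyck w) (dyck w′)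
  (trans (sym (tabulate-col-area d)) (trans (cong (tabulate ∘ col) e) (tabulate-col-area d′)))
  (trans (#E-dyck w) (trans (cong suc l) (sym (#E-dyck w′)))))
  where
  d  = dyck-isDyckPath w
  d′ : IsDyckPath (suc (length w)) (dyck w′)
  d′ = subst (λ r → IsDyckPath (suc r) (dyck w′)) (sym l) (dyck-isDyckPath w′)

-- From an Abelian area sequence back to its word

leading-zeros : ∀ ys → AllPairs _≤_ ys →
  ∃[ k ] ∃[ c ] ys ≡ replicate k 0 ++ c × All (1 ≤_) c × AllPairs _≤_ c
leading-zeros []           _ = 0 , [] , refl , [] , []
leading-zeros (zero ∷ ys)  (_ ∷ s) =
  let k , c , e , p , s′ = leading-zeros ys s in suc k , c , cong (0 ∷_) e , p , s′
leading-zeros (suc y ∷ ys) (y≤ ∷ s) =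
  0 , suc y ∷ ys , refl , s≤s z≤n ∷ All.map (≤-trans (s≤s z≤n)) y≤ , y≤ ∷ s

-- The path from the line of abscissa x to that of abscissa k whose N steps have abscissas ys.
fill : ℕ → ℕ → List ℕ → Path
fill x k []       = replicate (k ∸ x) E
fill x k (y ∷ ys) = replicate (y ∸ x) E ++ N ∷ fill y k ys

columns-E-++ : ∀ x j w → columns x (replicate j E ++ w) ≡ columns (x + j) w
columns-E-++ x zero    w = cong (λ x → columns x w) (sym (+-identityʳ x))
columns-E-++ x (suc j) w = trans (columns-E-++ (suc x) j w) (cong (λ x → columns x w) (sym (+-suc x j)))

columns-fill : ∀ x k ys → All (x ≤_) ys → AllPairs _≤_ ys → columns x (fill x k ys) ≡ ys
columns-fill x k []       _         _          = columns-++-E x [] (k ∸ x)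
columns-fill x k (y ∷ ys) (x≤y ∷ _) (y≤ys ∷ s) = trans (columns-E-++ x (y ∸ x) _)
  (trans (cong (λ x → columns x (N ∷ fill y k ys)) (m+[n∸m]≡n x≤y)) (cong (y ∷_) (columns-fill y k ys y≤ys s)))

#E-fill : ∀ x k ys → x ≤ k → All (x ≤_) ys → All (_≤ k) ys → AllPairs _≤_ ys → x + #E (fill x k ys) ≡ k
#E-fill x k []       x≤k _ _ _ = trans (cong (λ l → x + l) (#E-replicateE (k ∸ x))) (m+[n∸m]≡n x≤k)
#E-fill x k (y ∷ ys) x≤k (x≤y ∷ _) (y≤k ∷ ≤k) (y≤ys ∷ s) = begin
  x + #E (replicate (y ∸ x) E ++ N ∷ fill y k ys)
    ≡⟨ cong (λ l → x + l) (trans (#E-++ (replicate (y ∸ x) E) _) (cong (_+ #E (fill y k ys)) (#E-replicateE (y ∸ x)))) ⟩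
  x + (y ∸ x + #E (fill y k ys))
    ≡⟨ +-assoc x (y ∸ x) _ ⟨
  x + (y ∸ x) + #E (fill y k ys)
    ≡⟨ cong (_+ #E (fill y k ys)) (m+[n∸m]≡n x≤y) ⟩
  y + #E (fill y k ys)
    ≡⟨ #E-fill y k ys y≤k y≤ys ≤k s ⟩
  k ∎
  where open ≡-Reasoning

-- The zero columns form the initial run of N steps and fix the abscissa k + 1 at which the word
-- must end. The positive columns are its N steps; being Abelian keeps them at or before that
-- abscissa.
area-surjective : ∀ {r} (a : Vec ℕ (suc r)) → IsAbelianAreaSequence a →
                  ∃[ w ] length w ≡ r × area (suc r) (dyck w) ≡ a
area-surjective {r} a (isArea , abelian)
  with leading-zeros (tabulate (col a)) (AllPairs.tabulate⁺-< {f = col a} λ i<j → col-mono a isArea (<⇒≤ i<j))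
... | zero , [] , () , _ , _
-- The first column is 0 ∸ a₁ = 0, so the initial run is not empty.
... | zero , y ∷ _ , e , 1≤y ∷ _ , _ =
  contradiction (subst (1 ≤_) (trans (sym (∷-injectiveˡ e)) (0∸n≡0 (lookup a zero))) 1≤y) λ ()
... | suc k , c , e , 1≤c , sorted = w , length-w , area≡
  where
  w : Path
  w = fill 1 (suc k) c

  nth-col : ∀ i → nth (replicate (suc k) 0 ++ c) (toℕ i) ≡ col a i
  nth-col i = trans (cong (λ xs → nth xs (toℕ i)) (sym e)) (nth-tabulate (col a) i)

  k+c≡r : k + length c ≡ r
  k+c≡r = suc-injective (trans (cong (_+ length c) (sym (length-replicate (suc k) {0})))
    (trans (sym (length-++ (replicate (suc k) 0)))
    (trans (cong length (sym e)) (length-tabulate (col a)))))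

  bound : ∀ i → col a i ≤ suc k
  -- If a positive column exists, the first one is at position k + 1, right after the k + 1 zeros,
  -- and `abelian⁻` applies there. Otherwise the position of i already gives the bound.
  bound i with suc k <? suc r
  ... | no  k≮r = ≤-trans (col≤ a i) (≤-trans (<⇒≤ (toℕ<n i)) (≮⇒≥ k≮r))
  ... | yes k<r = subst (col a i ≤_) v≡ (abelian⁻ a isArea abelian v (positive c 1≤c k+c≡r nth-v) i)
    where
    v = fromℕ< k<r
    v≡ = toℕ-fromℕ< k<r
    nth-v : nth c 0 ≡ col a v
    nth-v = trans (sym (nth-replicate-≡ (suc k) c))
      (trans (cong (nth (replicate (suc k) 0 ++ c)) (sym v≡)) (nth-col v))
    positive : ∀ c → All (1 ≤_) c → k + length c ≡ r → nth c 0 ≡ col a v → 0 < col a v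
    positive []      _         l _ = contradiction (trans (sym (+-identityʳ k)) l) (<⇒≢ (≤-pred k<r))
    positive (_ ∷ _) (1≤y ∷ _) _ refl = 1≤y

  c≤k : All (_≤ suc k) c
  c≤k = All.++⁻ʳ (replicate (suc k) 0) (subst (All (_≤ suc k)) e (All.tabulate⁺ bound))

  columns-w : columns 1 w ≡ c
  columns-w = columns-fill 1 (suc k) c 1≤c sorted

  #E-w : #E w ≡ k
  #E-w = suc-injective (#E-fill 1 (suc k) c (s≤s z≤n) 1≤c c≤k sorted)

  length-w : length w ≡ r
  length-w = trans (sym (#E+#N w)) (trans (cong₂ _+_ #E-w (trans (sym (length-columns 1 w)) (cong length columns-w))) k+c≡r)

  area≡ : area (suc r) (dyck w) ≡ a
  area≡ = trans (tabulate-cong λ i → begin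
      toℕ i ∸ nth (columns 0 (dyck w)) (toℕ i)
        ≡⟨ cong (λ xs → toℕ i ∸ nth xs (toℕ i)) (trans (columns-dyck w)
             (cong₂ (λ j ys → replicate (suc j) 0 ++ ys) #E-w columns-w)) ⟩
      toℕ i ∸ nth (replicate (suc k) 0 ++ c) (toℕ i)
        ≡⟨ cong (toℕ i ∸_) (nth-col i) ⟩
      toℕ i ∸ (toℕ i ∸ lookup a i)
        ≡⟨ m∸[m∸n]≡n (≤-pred (proj₁ isArea i)) ⟩
      lookup a i ∎)
    (tabulate∘lookup a)
    where open ≡-Reasoning

-- The correspondence between words and Abelian area sequences

wordArea : ∀ {r} → Vec Step r → Vec ℕ (suc r)
wordArea {r} w = area (suc r) (dyck (toList w))

wordArea-injective : ∀ {r} {w w′ : Vec Step r} → wordArea w ≡ wordArea w′ → w ≡ w′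
wordArea-injective {r} {w} {w′} e = trans (sym (cast-is-id refl w)) (toList-injective refl w w′ (area-injective
  (trans (length-toList w) (sym (length-toList w′)))
  (subst (λ r → area (suc r) (dyck (toList w)) ≡ area (suc r) (dyck (toList w′))) (sym (length-toList w)) e)))

wordArea-isAbelian : ∀ {r} (w : Vec Step r) → IsAbelianAreaSequence (wordArea w)
wordArea-isAbelian w = subst (λ r → IsAbelianAreaSequence (area (suc r) (dyck (toList w)))) (length-toList w)
  (area-isAreaSequence (dyck-isDyckPath (toList w)) , area-abelian (toList w))

peak-wordArea : ∀ {r} (w : Vec Step r) → peak (wordArea w) ≡ suc (peaksE (toList w))
peak-wordArea w = subst (λ r → peak (area (suc r) (dyck (toList w))) ≡ suc (peaksE (toList w)))
  (length-toList w) (peak-area (toList w))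

∈-words : ∀ {r} (w : Vec Step r) → w ∈ words r
∈-words w = ∈-vectors w (λ i → letter (lookup w i))
  where
  letter : ∀ s → s ∈ (E ∷ N ∷ [])
  letter E = here refl
  letter N = there (here refl)

words-unique : ∀ r → Unique (words r)
words-unique = vectors-unique (((λ ()) ∷ []) ∷ [] ∷ [])

-- Both lists are free of repetitions and have the same elements, so injectivity and surjectivity of
-- `wordArea` suffice.
𝒜↭words : ∀ r → 𝒜 (suc r) ↭ map wordArea (words r)
𝒜↭words r = unique∧set⇒↭ (𝒜-unique (suc r)) (Unique.map⁺ wordArea-injective (words-unique r)) λ a → mk⇔
  (λ a∈ → preimage (area-surjective a (Equivalence.to (∈-𝒜 a) a∈)))
  (λ a∈ → let w , _ , a≡ = ∈-map⁻ wordArea a∈ in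
     Equivalence.from (∈-𝒜 a) (subst IsAbelianAreaSequence (sym a≡) (wordArea-isAbelian w)))
  where
  preimage : ∀ {a} → ∃[ w ] length w ≡ r × area (suc r) (dyck w) ≡ a → a ∈ map wordArea (words r)
  preimage (w , refl , refl) = subst (_∈ map wordArea (words r))
    (cong (area (suc r) ∘ dyck) (toList∘fromList w)) (∈-map⁺ wordArea (∈-words (fromList w)))

peak-genFun : ∀ r → X ⊠ genFun (peaksE ∘ toList) (words r) ≋ genFun peak (𝒜 (suc r))
peak-genFun r = ≋-sym (≋-trans (genFun-↭ peak (𝒜↭words r))
  (≋-trans (≡⇒≋ (genFun-map peak wordArea (words r)))
  (≋-trans (≡⇒≋ (genFun-cong (All.universal peak-wordArea (words r))))
  (genFun-suc (peaksE ∘ toList) (words r)))))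

-- Words without forbidden blocks

prepend : Step → Step → Path → Path
prepend x y w = x ∷ y ∷ w

-- The words w of length 2 n + 1 for which E w E, respectively N w E, has no
-- forbidden block. Equal letters in consecutive odd positions force the letter
-- between them, unequal ones leave it free.
goodE goodN : ℕ → List Path
goodE zero    = (E ∷ []) ∷ []
goodE (suc n) = map (prepend E E) (goodE n) ++ map (prepend E N) (goodN n) ++ map (prepend N N) (goodN n)
goodN zero    = (E ∷ []) ∷ (N ∷ []) ∷ []
goodN (suc n) = map (prepend N N) (goodN n) ++ map (prepend E E) (goodE n) ++ map (prepend N E) (goodE n)

genFun-++₃ : ∀ (f : Path → ℕ) (g h k : Path → Path) xs ys zs →
  genFun f (map g xs ++ map h ys ++ map k zs) ≋ genFun (f ∘ g) xs ⊞ (genFun (f ∘ h) ys ⊞ genFun (f ∘ k) zs)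
genFun-++₃ f g h k xs ys zs
  rewrite sym (genFun-map f g xs) | sym (genFun-map f h ys) | sym (genFun-map f k zs)
  = ≋-trans (genFun-++ f (map g xs) _) (⊞-cong (≋-refl {genFun f (map g xs)}) (genFun-++ f (map h ys) (map k zs)))

-- The exponent is n + 1 because a word of length 2 n + 1 between its two outer letters forms n + 1
-- blocks. At n = 0 the blocks are E E E, and N E E and N N E with one peak each.
genFun-good : ∀ n → genFun peaksE (goodE n) ≋ even 𝟙 X (suc n) × genFun peaksN (goodN n) ≋ X ⊠ odd 𝟙 X (suc n)
genFun-good zero = ≋E , ≋N
  where
  ≋E : genFun peaksE (goodE 0) ≋ even 𝟙 X 1
  ≋E .at zero          = refl
  ≋E .at (suc zero)    = refl
  ≋E .at (suc (suc k)) = refl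
  ≋N : genFun peaksN (goodN 0) ≋ X ⊠ odd 𝟙 X 1
  ≋N .at zero          = refl
  ≋N .at (suc zero)    = refl
  ≋N .at (suc (suc k)) = refl
genFun-good (suc n) =
    ≋-trans (genFun-++₃ peaksE (prepend E E) (prepend E N) (prepend N N) (goodE n) (goodN n) (goodN n))
    (≋-trans (⊞-cong ihE (⊞-cong ihN ihN))
      (solve 3 (λ x a b → a :+ (x :* b :+ x :* b) := con 1 :* a :+ x :* (b :+ b)) ≋-refl X a b))
  , ≋-trans (genFun-++₃ peaksN (prepend N N) (prepend E E) (prepend N E) (goodN n) (goodE n) (goodE n))
    (≋-trans (⊞-cong ihN (⊞-cong peak+E peak+E))
      (solve 3 (λ x a b → x :* b :+ (x :* a :+ x :* a) := x :* (con 1 :* b :+ (a :+ a))) ≋-refl X a b))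
  where
  open PolySolver
  a = even 𝟙 X (suc n)
  b = odd 𝟙 X (suc n)
  ihE = proj₁ (genFun-good n)
  ihN = proj₂ (genFun-good n)
  peak+E : genFun (suc ∘ peaksE) (goodE n) ≋ X ⊠ a
  peak+E = ≋-trans (genFun-suc peaksE (goodE n)) (⊠-congˡ X ihE)

map-prepend-unique : ∀ {x y xs} → Unique xs → Unique (map (prepend x y) xs)
map-prepend-unique = Unique.map⁺ (∷-injectiveʳ ∘ ∷-injectiveʳ)

map-prepend-disjoint : ∀ {x y x′ y′ xs ys} → (x , y) ≢ (x′ , y′) →
                       Disjoint (map (prepend x y) xs) (map (prepend x′ y′) ys)
map-prepend-disjoint ≢ (v∈ , v∈′) with ∈-map⁻ _ v∈ | ∈-map⁻ _ v∈′
... | _ , _ , refl | _ , _ , refl = ≢ refl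

++₃-unique : ∀ {xs ys zs : List Path} → Unique xs → Unique ys → Unique zs →
             Disjoint xs ys → Disjoint xs zs → Disjoint ys zs → Unique (xs ++ ys ++ zs)
++₃-unique {ys = ys} u v w xy xz yz = Unique.++⁺ u (Unique.++⁺ v w yz) λ (∈xs , ∈r) →
  [ (λ ∈ys → xy (∈xs , ∈ys)) , (λ ∈zs → xz (∈xs , ∈zs)) ]′ (∈-++⁻ ys ∈r)

good-unique : ∀ n → Unique (goodE n) × Unique (goodN n)
good-unique zero    = ([] ∷ []) , (((λ ()) ∷ []) ∷ [] ∷ [])
good-unique (suc n) =
    ++₃-unique (map-prepend-unique uE) (map-prepend-unique uN) (map-prepend-unique uN)
      (map-prepend-disjoint λ ()) (map-prepend-disjoint λ ()) (map-prepend-disjoint λ ())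
  , ++₃-unique (map-prepend-unique uN) (map-prepend-unique uE) (map-prepend-unique uE)
      (map-prepend-disjoint λ ()) (map-prepend-disjoint λ ()) (map-prepend-disjoint λ ())
  where
  uE = proj₁ (good-unique n)
  uN = proj₂ (good-unique n)

AllowedBlock : Path → Set
AllowedBlock b = b ≢ E ∷ N ∷ E ∷ [] × b ≢ N ∷ E ∷ N ∷ []

-- Blocks are numbered from 1: because 2 j ∸ 2 is truncated, the shift by two letters is valid only
-- from index 1 on the right.
block-suc : ∀ x y S j → block (x ∷ y ∷ S) (suc (suc j)) ≡ block S (suc j)
block-suc x y S j = trans
  (cong (λ i → List.take 3 (List.drop (i ∸ 2) (x ∷ y ∷ S))) (trans (2*suc (suc j)) (cong (λ i → 2 + i) (2*suc j))))
  (cong (λ i → List.take 3 (List.drop (i ∸ 2) S)) (sym (2*suc j)))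

-- Consecutive blocks overlap in one letter, so the remaining word starts with z again.
noForbidden⁺ : ∀ {n x y z w} → AllowedBlock (x ∷ y ∷ z ∷ []) →
               NoForbiddenBlock n (z ∷ w) → NoForbiddenBlock (suc n) (x ∷ y ∷ z ∷ w)
noForbidden⁺ ok rest (suc zero)    _ _         = ok
noForbidden⁺ {x = x} {y} {z} {w} ok rest (suc (suc j)) _ (s≤s j≤n) =
  subst AllowedBlock (sym (block-suc x y (z ∷ w ++ E ∷ []) j)) (rest (suc j) (s≤s z≤n) j≤n)

noForbidden⁻ : ∀ {n x y z w} → NoForbiddenBlock (suc n) (x ∷ y ∷ z ∷ w) →
               AllowedBlock (x ∷ y ∷ z ∷ []) × NoForbiddenBlock n (z ∷ w)
noForbidden⁻ {n} {x} {y} {z} {w} ok = ok 1 ≤-refl (s≤s z≤n) , rest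
  where
  rest : NoForbiddenBlock n (z ∷ w)
  rest (suc j) _ j≤n = subst AllowedBlock (block-suc x y (z ∷ w ++ E ∷ []) j) (ok (suc (suc j)) (s≤s z≤n) (s≤s j≤n))

-- The specification of `goodE` for x = E and of `goodN` for x = N. The closing E is already
-- supplied by `NoForbiddenBlock`.
Good : Step → ℕ → Path → Set
Good x n w = length w ≡ suc (2 * n) × NoForbiddenBlock (suc n) (x ∷ w)

good⁺ : ∀ {n x y z w} → AllowedBlock (x ∷ y ∷ z ∷ []) → Good z n w → Good x (suc n) (y ∷ z ∷ w)
good⁺ {n} ok (l , g) = trans (cong (λ i → 2 + i) l) (cong suc (sym (2*suc n))) , noForbidden⁺ ok g

good⁻ : ∀ {n x y z w} → Good x (suc n) (y ∷ z ∷ w) → AllowedBlock (x ∷ y ∷ z ∷ []) × Good z n w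
good⁻ {n} (l , g) = let ok , g′ = noForbidden⁻ g in
  ok , suc-injective (suc-injective (trans l (cong suc (2*suc n)))) , g′

∈-good⁻ : ∀ n {w} → (w ∈ goodE n → Good E n w) × (w ∈ goodN n → Good N n w)
∈-good⁻ zero = (λ { (here refl) → refl , λ { (suc zero) _ _ → (λ ()) , λ () ; (suc (suc j)) _ (s≤s ()) } })
             , (λ { (here refl) → refl , λ { (suc zero) _ _ → (λ ()) , λ () ; (suc (suc j)) _ (s≤s ()) }
                  ; (there (here refl)) → refl , λ { (suc zero) _ _ → (λ ()) , λ () ; (suc (suc j)) _ (s≤s ()) } })
∈-good⁻ (suc n) = fromE , fromN
  where
  fromE : ∀ {w} → w ∈ goodE (suc n) → Good E (suc n) w
  fromE w∈ with ∈-++⁻ (map (prepend E E) (goodE n)) w∈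
  ... | inj₁ w∈₁ with ∈-map⁻ _ w∈₁
  ...   | _ , u∈ , refl = good⁺ ((λ ()) , λ ()) (proj₁ (∈-good⁻ n) u∈)
  fromE w∈ | inj₂ w∈₂₃ with ∈-++⁻ (map (prepend E N) (goodN n)) w∈₂₃
  ... | inj₁ w∈₂ with ∈-map⁻ _ w∈₂
  ...   | _ , u∈ , refl = good⁺ ((λ ()) , λ ()) (proj₂ (∈-good⁻ n) u∈)
  fromE w∈ | inj₂ w∈₂₃ | inj₂ w∈₃ with ∈-map⁻ _ w∈₃
  ...   | _ , u∈ , refl = good⁺ ((λ ()) , λ ()) (proj₂ (∈-good⁻ n) u∈)
  fromN : ∀ {w} → w ∈ goodN (suc n) → Good N (suc n) w
  fromN w∈ with ∈-++⁻ (map (prepend N N) (goodN n)) w∈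
  ... | inj₁ w∈₁ with ∈-map⁻ _ w∈₁
  ...   | _ , u∈ , refl = good⁺ ((λ ()) , λ ()) (proj₂ (∈-good⁻ n) u∈)
  fromN w∈ | inj₂ w∈₂₃ with ∈-++⁻ (map (prepend E E) (goodE n)) w∈₂₃
  ... | inj₁ w∈₂ with ∈-map⁻ _ w∈₂
  ...   | _ , u∈ , refl = good⁺ ((λ ()) , λ ()) (proj₁ (∈-good⁻ n) u∈)
  fromN w∈ | inj₂ w∈₂₃ | inj₂ w∈₃ with ∈-map⁻ _ w∈₃
  ...   | _ , u∈ , refl = good⁺ ((λ ()) , λ ()) (proj₁ (∈-good⁻ n) u∈)

-- With the preceding letter, the first two letters of w form a block. Two of the eight cases are
-- forbidden; the other six are the six sublists in the recursion.
∈-good⁺ : ∀ n {w} → (Good E n w → w ∈ goodE n) × (Good N n w → w ∈ goodN n)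
∈-good⁺ zero {E ∷ []} = (λ _ → here refl) , (λ _ → here refl)
∈-good⁺ zero {N ∷ []} = (λ (_ , g) → contradiction refl (proj₁ (g 1 ≤-refl ≤-refl))) , (λ _ → there (here refl))
∈-good⁺ zero {[]} = (λ { (() , _) }) , (λ { (() , _) })
∈-good⁺ zero {_ ∷ _ ∷ _} = (λ { (() , _) }) , (λ { (() , _) })
∈-good⁺ (suc n) {[]} = (λ { (() , _) }) , (λ { (() , _) })
∈-good⁺ (suc n) {_ ∷ []} = (λ (l , _) → contradiction (trans l (cong suc (2*suc n))) λ ())
                         , (λ (l , _) → contradiction (trans l (cong suc (2*suc n))) λ ())
∈-good⁺ (suc n) {E ∷ E ∷ w} =
    (λ g → ∈-++⁺ˡ (∈-map⁺ _ (proj₁ (∈-good⁺ n) (proj₂ (good⁻ g)))))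
  , (λ g → ∈-++⁺ʳ (map (prepend N N) (goodN n)) (∈-++⁺ˡ (∈-map⁺ _ (proj₁ (∈-good⁺ n) (proj₂ (good⁻ g))))))
∈-good⁺ (suc n) {E ∷ N ∷ w} =
    (λ g → ∈-++⁺ʳ (map (prepend E E) (goodE n)) (∈-++⁺ˡ (∈-map⁺ _ (proj₂ (∈-good⁺ n) (proj₂ (good⁻ g))))))
  , (λ g → contradiction refl (proj₂ (proj₁ (good⁻ {n} g))))
∈-good⁺ (suc n) {N ∷ E ∷ w} =
    (λ g → contradiction refl (proj₁ (proj₁ (good⁻ {n} g))))
  , (λ g → ∈-++⁺ʳ (map (prepend N N) (goodN n)) (∈-++⁺ʳ (map (prepend E E) (goodE n))
      (∈-map⁺ _ (proj₁ (∈-good⁺ n) (proj₂ (good⁻ g))))))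
∈-good⁺ (suc n) {N ∷ N ∷ w} =
    (λ g → ∈-++⁺ʳ (map (prepend E E) (goodE n)) (∈-++⁺ʳ (map (prepend E N) (goodN n))
      (∈-map⁺ _ (proj₂ (∈-good⁺ n) (proj₂ (good⁻ g))))))
  , (λ g → ∈-++⁺ˡ (∈-map⁺ _ (proj₂ (∈-good⁺ n) (proj₂ (good⁻ g)))))

-- The counted paths

dyck-isPair : ∀ w → IsPair (suc (length w)) (dyck w) (suc (#E w)) (E ∷ w)
dyck-isPair w = record
  { 1≤k     = s≤s z≤n
  ; k≤m     = s≤s (subst (#E w ≤_) (#E+#N w) (m≤m+n (#E w) (#N w)))
  ; L-E     = refl
  ; L-N     = cong suc (#E+#N w)
  ; L-first = w , refl
  ; word    = cong (λ j → replicate (suc (#E w)) N ++ (E ∷ w) ++ replicate j E)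
                (sym (trans (cong (_∸ #E w) (sym (#E+#N w))) (m+n∸m≡n (#E w) (#N w))))
  }

isPair⇒dyck : ∀ {m v k L} → IsPair m v k L → ∃[ w ] L ≡ E ∷ w × v ≡ dyck w × suc (length w) ≡ m
isPair⇒dyck {m} {v} {k} pair with IsPair.L-first pair
... | w , refl = w , refl , v≡ , m≡
  where
  open IsPair pair
  m≡ : suc (length w) ≡ m
  m≡ = trans (cong suc (sym (#E+#N w))) (trans (cong (_+ #N w) L-E) L-N)
  v≡ : v ≡ dyck w
  v≡ = trans word (cong₂ (λ k j → replicate k N ++ (E ∷ w) ++ replicate j E) (sym L-E)
    (trans (cong (_∸ k) (sym L-N)) (m+n∸m≡n k (#N w))))

countedPaths : ℕ → ℕ → List Path
countedPaths n i = map dyck (filter (λ w → peaksE w ≟ i) (goodE n))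

-- Both sides are the coefficient of tⁱ in the even part of (1 + 2 √t)ⁿ⁺¹, which enumerates the
-- admissible words by peaks and is also `gamma (suc n)`.
length-countedPaths : ∀ n i → length (countedPaths n i) ≡ weight (suc n) (2 * i)
length-countedPaths n i = trans (length-map dyck (filter (λ w → peaksE w ≟ i) (goodE n))) (ℤ.+-injective
  (trans (sym (coeff-genFun peaksE (goodE n) i))
  (trans (at (≋-trans (proj₁ (genFun-good n)) (≋-sym (gamma-even (suc n)))) i) (coeff-gamma (suc n) i))))

countedPaths-unique : ∀ n i → Unique (countedPaths n i)
countedPaths-unique n i = Unique.map⁺ dyck-injective
  (Unique.filter⁺ (λ w → peaksE w ≟ i) (proj₁ (good-unique n)))

∈-countedPaths : ∀ n i v → v ∈ countedPaths n i ⇔ IsCountedPath (suc n) i v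
∈-countedPaths n i v = mk⇔ to from
  where
  to : v ∈ countedPaths n i → IsCountedPath (suc n) i v
  to v∈ with ∈-map⁻ dyck v∈
  ... | w , w∈ , refl with ∈-filter⁻ (λ w → peaksE w ≟ i) {xs = goodE n} w∈
  ...   | w∈good , refl with proj₁ (∈-good⁻ n) w∈good
  ...     | l , g = record
    { abelianDyck = subst (λ m → IsAbelianDyckPath m (dyck w)) m≡ (dyck-isAbelianDyckPath w)
    ; i+1-peaks   = trans (peaks-dyck w) (+-comm 1 (peaksE w))
    ; pair        = subst (λ m → IsPair m (dyck w) (suc (#E w)) (E ∷ w)) m≡ (dyck-isPair w)
    ; noForbidden = g
    }
    where
    m≡ : suc (length w) ≡ 2 * suc n
    m≡ = trans (cong suc l) (sym (2*suc n))
  from : IsCountedPath (suc n) i v → v ∈ countedPaths n i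
  from c with isPair⇒dyck (IsCountedPath.pair c)
  ... | w , refl , refl , m≡ = ∈-map⁺ dyck (∈-filter⁺ (λ w → peaksE w ≟ i)
    (proj₁ (∈-good⁺ n) (suc-injective (trans m≡ (2*suc n)) , IsCountedPath.noForbidden c))
    (suc-injective (trans (sym (peaks-dyck w)) (trans (IsCountedPath.i+1-peaks c) (+-comm i 1)))))

proposition4p12 : ∀ (n : ℕ) → 1 ≤ n →
    (∃[ p ] ∃[ γ ]
    X ⊠ p ≈ Peak (2 * n)
    × IsGammaPolynomial p γ
    × γ ≈ ∑[0⋯ ⌊ n /2⌋ ] (λ i → (+ (2 ^ (2 * i) * (n C (2 * i)))) ∙ X ^ᴾ i)
    × (+ 2) ∙ γ ⟪ X ^ᴾ 2 ⟫ ≈ (𝟙 ⊞ (+ 2) ∙ X) ^ᴾ n ⊞ (𝟙 ⊟ (+ 2) ∙ X) ^ᴾ n)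
    × (∀ i → i ≤ ⌊ n /2⌋ →
    HasCardinality (IsCountedPath n i) (2 ^ (2 * i) * (n C (2 * i))))
proposition4p12 (suc n) _ =
    -- The words have one letter less than the semilength, and suc (pred (2 * suc n)) reduces to 2 *
    -- suc n, so no transport is required.
    ( genFun (peaksE ∘ toList) (words (pred (2 * suc n))) , gamma (suc n)
    , at (peak-genFun (pred (2 * suc n)))
    , gamma-isGammaPolynomial (suc n) (genFun-words-even n)
    , at (gamma-sum (suc n))
    , at (gamma-closedForm (suc n)))
  , λ i _ → countedPaths n i , countedPaths-unique n i , ∈-countedPaths n i , length-countedPaths n i
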